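{- For each positive integer $k$ and integers $q\ge 2$ let \[ g_k(q) = \min \{ |A-A| : A\subset \mathbb{Z} \text{ finite},\ kA \supset \{a+1, \ldots, a+q \} \text{ for some integer } a \}, \] and put $\beta_k = \inf_{q\geq 2} \frac{\log g_k(q)}{\log q}$. Then: (a) $\frac{2}{k} - \frac{1}{k^2} \leq \beta_k \leq \frac{2}{k}$ for all positive integers $k$; (b) the sequence $k\beta_k$ is increasing in $k$.
   Context: For a set $A$ of integers, $kA = A+\cdots+A$ ($k$ times) is the set of all sums of $k$ elements of $A$, and $A-A=\{a-b: a,b\in A\}$. -}

module Defs where

open import Data.Nat using (ℕ; zero; suc; _≤_; _^_; _*_; _∸_)
open import Data.Integer as ℤ using (ℤ; +_)
open import Data.List using (List; length)
open import Data.List.Membership.Propositional using (_∈_)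
open import Data.List.Relation.Unary.Unique.Propositional using (Unique)
open import Data.Product using (Σ; ∃; ∃-syntax; _×_)
open import Function.Bundles using (_⇔_)
open import Relation.Binary.PropositionalEquality using (_≡_)

data InSumset (A : List ℤ) : ℕ → ℤ → Set where
  sum-zero : InSumset A zero (+ 0)
  sum-suc  : ∀ {k x a} → a ∈ A → InSumset A k x → InSumset A (suc k) (a ℤ.+ x)

InDiff : List ℤ → ℤ → Set
InDiff A x = ∃[ a ] ∃[ b ] (a ∈ A × b ∈ A × x ≡ a ℤ.- b)

DiffCard : List ℤ → ℕ → Set
DiffCard A n = ∃[ D ] (Unique D × (∀ x → (x ∈ D ⇔ InDiff A x)) × length D ≡ n)

CoversInterval : ℕ → List ℤ → ℕ → Set
CoversInterval k A q =
  ∃[ a ] (∀ (i : ℕ) → 1 ≤ i → i ≤ q → InSumset A k (a ℤ.+ + i))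

-- n is one of the values |A - A| over finite A with kA ⊇ {a+1,…,a+q};
-- g_k(q) is the minimum of these values.
Achievable : ℕ → ℕ → ℕ → Set
Achievable k q n = ∃[ A ] (CoversInterval k A q × DiffCard A n)

-- "s/t ≤ β_k", where β_k = inf_{q ≥ 2} log g_k(q) / log q  (t ≥ 1).
-- For q ≥ 2:  s/t ≤ log g_k(q)/log q  ⇔  q^s ≤ g_k(q)^t,
-- and q^s ≤ g_k(q)^t = (min of achievable n)^t ⇔ q^s ≤ n^t for all achievable n.
BetaAtLeast : ℕ → ℕ → ℕ → Set
BetaAtLeast k s t = ∀ (q : ℕ) → 2 ≤ q → ∀ (n : ℕ) → Achievable k q n → q ^ s ≤ n ^ t

{-# OPTIONS --safe #-}

-- For every finite A, a lower bound s/t for β_k gives |kA|^s ≤ |A − A|^t, so the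
-- interval in the definition of β_k may be replaced by the size of kA.  Indeed let
-- |kA| = L.  Choose M ≈ const · L^m coprime to all nonzero differences of kA, and take
-- P = A + c₁A + … with m summands and random cᵢ mod M; few pairs collide, so kP fills a
-- constant proportion of ℤ/M, and O(m) translates of kP fill it completely.  Adding those
-- translates and a bounded number of multiples of M to P yields an interval of
-- length M ≥ L^m at the cost of a factor O(m²) in |P − P| ≤ |A − A|^m; let m → ∞.
-- Monotonicity of k β_k then follows from |(k+1)A|^k ≤ C |kA|^(k+1), a Loomis–Whitney
-- inequality for lexicographically minimal representations; C is removed by passing to
-- A + qA + … + q^(m−1)A.
-- The lower bound in (a) combines |kA| ≤ |A|^k with |kA| |A|^(k−1) ≤ |A − A|^k, proved by
-- Petridis' method, and the upper bound comes from the digits in base b.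

module Submission where

open import Defs
open import Data.Nat
open import Data.Nat.Coprimality using (Coprime; coprime-divisor)
open import Data.Nat.DivMod using (m/n*n≤m; m≡m%n+[m/n]*n; m%n<n; m<n*o⇒m/o<n)
import Data.Nat.Divisibility as ℕ∣
open import Data.Nat.ListAction using (sum)
open import Data.Nat.Properties
open import Data.Nat.Tactic.RingSolver using (solve-∀)
open import Data.Integer as ℤ using (ℤ; +_; -[1+_])
open import Data.Integer.DivMod using (_%ℕ_; _/ℕ_; n%ℕd<d; a≡a%ℕn+[a/ℕn]*n)
import Data.Integer.Divisibility.Signed as ℤ∣
import Data.Integer.Properties as ℤ
import Data.Integer.Tactic.RingSolver as ℤSolver
import Algebra.Properties.AbelianGroup ℤ.+-0-abelianGroup as ℤ+
open import Data.Fin using (zero; suc)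
open import Data.List using (List; []; _∷_; _++_; length; map; filter; deduplicate; cartesianProduct; cartesianProductWith; upTo)
open import Data.List.Properties
open import Data.List.Membership.DecPropositional ℤ._≟_ using (_∈?_)
open import Data.List.Membership.Propositional using (_∈_; find; lose)
open import Data.List.Membership.Propositional.Properties
open import Data.List.Relation.Binary.Subset.Propositional using (_⊆_)
open import Data.List.Relation.Unary.All as All using (All; []; _∷_)
open import Data.List.Relation.Unary.AllPairs as AllPairs using (AllPairs; []; _∷_)
import Data.List.Relation.Unary.AllPairs.Properties as AllPairs
open import Data.List.Relation.Unary.Any using (here; there; any?)
open import Data.List.Relation.Unary.Unique.Propositional using (Unique)
import Data.List.Relation.Unary.Unique.Propositional.Properties as Unique
import Data.List.Relation.Unary.Unique.DecPropositional.Properties as DecUnique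
open import Data.Vec as Vec using (Vec; []; _∷_; removeAt; lookup)
open import Data.Vec.Relation.Unary.All as VecAll using ([]; _∷_)
open import Data.Product using (∃; ∃₂; _×_; _,_; proj₁; proj₂)
open import Data.Sum using (_⊎_; inj₁; inj₂)
open import Data.Empty using (⊥; ⊥-elim)
open import Function using (_∘_; id; case_of_; mk⇔; Equivalence)
open import Level using (0ℓ)
open import Relation.Binary.Definitions using (tri<; tri≈; tri>)
open import Relation.Binary.PropositionalEquality
open import Relation.Nullary
open import Relation.Unary using (Pred; Decidable)

-- All three claims concern rational lower bounds s/t for β_k, so neither logarithms nor infima
-- occur: β_k ≤ 2/k says that every such s/t is at most 2/k, and monotonicity says that a bound
-- s/(kt) for β_k yields s/((k+1)t) for β_(k+1).
--
-- The obstacle in (b) is that the hypothesis on β_k speaks only of sets whose k-fold sums contain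
-- an interval. An interval in (k+1)A forces kA to be large but tells nothing of its structure.
-- Hence the passage from size to interval, the longest part of the proof.
--
-- Losses there are harmless if polynomial in m: a^m ≤ C m^e b^m for all m ≥ 1 forces a ≤ b. Two
-- points keep them polynomial. The density of the sums in ℤ/M has a lower bound independent of m,
-- so O(log M) = O(m) translates suffice; and differences of the final set are counted through
-- products of differences of A, never through pairs of its elements, so that the main factor is
-- exactly |A - A|^m.

private variable
  𝐴 𝐵 𝐶 : Set

-- Lists as finite sets: cardinality, sumsets and difference sets

unique-⊆⇒length≤ : {xs ys : List 𝐴} → Unique xs → xs ⊆ ys → length xs ≤ length ys
unique-⊆⇒length≤ {xs = []} _ _ = z≤n
unique-⊆⇒length≤ {xs = x ∷ xs} (x∉ ∷ uxs) xs⊆ys with ∈-∃++ (xs⊆ys (here refl))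
... | as , bs , refl = begin
  suc (length xs)            ≤⟨ s≤s (unique-⊆⇒length≤ uxs xs⊆) ⟩
  suc (length (as ++ bs))    ≡⟨ cong suc (length-++ as) ⟩
  suc (length as + length bs) ≡⟨ +-suc (length as) _ ⟨
  length as + suc (length bs) ≡⟨ length-++ as ⟨
  length (as ++ x ∷ bs)      ∎
  where
  open ≤-Reasoning
  xs⊆ : xs ⊆ as ++ bs
  xs⊆ {z} z∈ with ∈-++⁻ as (xs⊆ys (there z∈))
  ... | inj₁ p = ∈-++⁺ˡ p
  ... | inj₂ (here refl) = ⊥-elim (All.lookup x∉ z∈ refl)
  ... | inj₂ (there p) = ∈-++⁺ʳ as p

length>0⇒∈ : {xs : List 𝐴} → 0 < length xs → ∃ (_∈ xs)
length>0⇒∈ {xs = x ∷ _} _ = x , here refl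

nub : List ℤ → List ℤ
nub = deduplicate ℤ._≟_

nub-unique : ∀ xs → Unique (nub xs)
nub-unique = DecUnique.deduplicate-! ℤ._≟_

∈-nub⁺ : ∀ {xs x} → x ∈ xs → x ∈ nub xs
∈-nub⁺ = ∈-deduplicate⁺ ℤ._≟_

∈-nub⁻ : ∀ xs {x} → x ∈ nub xs → x ∈ xs
∈-nub⁻ = ∈-deduplicate⁻ ℤ._≟_

card : List ℤ → ℕ
card xs = length (nub xs)

unique⇒length≤card : ∀ {xs ys} → Unique xs → xs ⊆ ys → length xs ≤ card ys
unique⇒length≤card u s = unique-⊆⇒length≤ u (∈-nub⁺ ∘ s)

card≤length : ∀ {xs} ys → xs ⊆ ys → card xs ≤ length ys
card≤length {xs} ys s = unique-⊆⇒length≤ (nub-unique xs) (s ∘ ∈-nub⁻ xs)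

card>0 : ∀ {A a} → a ∈ A → 0 < card A
card>0 a∈ = ∈-length (∈-nub⁺ a∈)

card>0⇒∈ : ∀ {A} → 0 < card A → ∃ (_∈ A)
card>0⇒∈ {A} A≢∅ with length>0⇒∈ {xs = nub A} A≢∅
... | a , a∈ = a , ∈-nub⁻ A a∈

card-mono : ∀ {xs ys} → xs ⊆ ys → card xs ≤ card ys
card-mono {xs} s = unique⇒length≤card (nub-unique xs) (s ∘ ∈-nub⁻ xs)

length-cartesianProductWith : ∀ (f : 𝐴 → 𝐵 → 𝐶) xs ys →
  length (cartesianProductWith f xs ys) ≡ length xs * length ys
length-cartesianProductWith f [] ys = refl
length-cartesianProductWith f (x ∷ xs) ys = trans (length-++ (map (f x) ys))
  (cong₂ _+_ (length-map (f x) ys) (length-cartesianProductWith f xs ys))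

infixl 6 _⊕_ _⊖_

_⊕_ : List ℤ → List ℤ → List ℤ
_⊕_ = cartesianProductWith ℤ._+_

_⊖_ : List ℤ → List ℤ → List ℤ
_⊖_ = cartesianProductWith ℤ._-_

∈-⊕⁺ : ∀ {xs ys x y} → x ∈ xs → y ∈ ys → x ℤ.+ y ∈ xs ⊕ ys
∈-⊕⁺ = ∈-cartesianProductWith⁺ ℤ._+_

∈-⊕⁻ : ∀ xs ys {z} → z ∈ xs ⊕ ys → ∃₂ λ x y → x ∈ xs × y ∈ ys × z ≡ x ℤ.+ y
∈-⊕⁻ xs ys = ∈-cartesianProductWith⁻ ℤ._+_ xs ys

∈-⊖⁺ : ∀ {xs ys x y} → x ∈ xs → y ∈ ys → x ℤ.- y ∈ xs ⊖ ys
∈-⊖⁺ = ∈-cartesianProductWith⁺ ℤ._-_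

∈-⊖⁻ : ∀ xs ys {z} → z ∈ xs ⊖ ys → ∃₂ λ x y → x ∈ xs × y ∈ ys × z ≡ x ℤ.- y
∈-⊖⁻ xs ys = ∈-cartesianProductWith⁻ ℤ._-_ xs ys

⊕-mono : ∀ {xs xs′ ys ys′} → xs ⊆ xs′ → ys ⊆ ys′ → xs ⊕ ys ⊆ xs′ ⊕ ys′
⊕-mono {xs} {ys = ys} s t z∈ with ∈-⊕⁻ xs ys z∈
... | x , y , x∈ , y∈ , refl = ∈-⊕⁺ (s x∈) (t y∈)

card-⊕ : ∀ xs ys → card (xs ⊕ ys) ≤ card xs * card ys
card-⊕ xs ys = ≤-trans (card≤length (nub xs ⊕ nub ys) (⊕-mono (∈-nub⁺ {xs}) (∈-nub⁺ {ys})))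
  (≤-reflexive (length-cartesianProductWith ℤ._+_ (nub xs) (nub ys)))

infixr 7 _·_

_·_ : ℕ → List ℤ → List ℤ
zero · A = + 0 ∷ []
suc k · A = A ⊕ k · A

InSumset⇒∈ : ∀ {A k x} → InSumset A k x → x ∈ k · A
InSumset⇒∈ sum-zero = here refl
InSumset⇒∈ (sum-suc a∈ x∈) = ∈-⊕⁺ a∈ (InSumset⇒∈ x∈)

∈⇒InSumset : ∀ {A} k {x} → x ∈ k · A → InSumset A k x
∈⇒InSumset zero (here refl) = sum-zero
∈⇒InSumset {A} (suc k) x∈ with ∈-⊕⁻ A (k · A) x∈
... | a , y , a∈ , y∈ , refl = sum-suc a∈ (∈⇒InSumset k y∈)

card-· : ∀ k A → card (k · A) ≤ card A ^ k
card-· zero A = ≤-refl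
card-· (suc k) A = ≤-trans (card-⊕ A (k · A)) (*-monoʳ-≤ (card A) (card-· k A))

diffCard : ∀ A → DiffCard A (card (A ⊖ A))
diffCard A = nub (A ⊖ A) , nub-unique (A ⊖ A) , (λ x → mk⇔ (to x) from) , refl
  where
  to : ∀ x → x ∈ nub (A ⊖ A) → InDiff A x
  to x x∈ with ∈-⊖⁻ A A (∈-nub⁻ (A ⊖ A) x∈)
  ... | a , b , a∈ , b∈ , e = a , b , a∈ , b∈ , e
  from : ∀ {x} → InDiff A x → x ∈ nub (A ⊖ A)
  from (a , b , a∈ , b∈ , refl) = ∈-nub⁺ (∈-⊖⁺ a∈ b∈)

DiffCard⇒≡ : ∀ {A n} → DiffCard A n → n ≡ card (A ⊖ A)
DiffCard⇒≡ {A} (D , uD , D⇔ , refl) = ≤-antisym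
  (unique⇒length≤card uD (λ {x} x∈ → case Equivalence.to (D⇔ x) x∈ of λ where
    (a , b , a∈ , b∈ , refl) → ∈-⊖⁺ a∈ b∈))
  (card≤length D (λ {x} x∈ → case ∈-⊖⁻ A A x∈ of λ where
    (a , b , a∈ , b∈ , refl) → Equivalence.from (D⇔ _) (a , b , a∈ , b∈ , refl)))

interval : ℤ → ℕ → List ℤ
interval a q = map (λ i → a ℤ.+ + suc i) (upTo q)

interval-unique : ∀ a q → Unique (interval a q)
interval-unique a q = Unique.map⁺ (λ {i} {j} e → suc-injective (ℤ.+-injective (ℤ+.∙-cancelˡ a _ _ e))) (Unique.upTo⁺ q)

covers⇒≤card : ∀ {k A q} → CoversInterval k A q → q ≤ card (k · A)
covers⇒≤card {k} {A} {q} (a , cov) = ≤-trans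
  (≤-reflexive (sym (trans (length-map _ (upTo q)) (length-upTo q))))
  (unique⇒length≤card (interval-unique a q) (λ x∈ → case ∈-map⁻ _ x∈ of λ where
    (i , i∈ , refl) → InSumset⇒∈ (cov (suc i) (s≤s z≤n) (∈-upTo⁻ i∈))))

-- Petridis' method

^-distribʳ-* : ∀ m n o → (m * n) ^ o ≡ m ^ o * n ^ o
^-distribʳ-* m n zero = refl
^-distribʳ-* m n (suc o) = trans (cong (m * n *_) (^-distribʳ-* m n o)) (rearrange m n (m ^ o) (n ^ o))
  where
  rearrange : ∀ a b c d → a * b * (c * d) ≡ a * c * (b * d)
  rearrange = solve-∀

length-filter-¬ : {P : Pred 𝐴 0ℓ} (P? : Decidable P) (xs : List 𝐴) →
  length (filter P? xs) + length (filter (¬? ∘ P?) xs) ≡ length xs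
length-filter-¬ P? [] = refl
length-filter-¬ P? (x ∷ xs) with P? x
... | yes _ = cong suc (length-filter-¬ P? xs)
... | no _ = trans (+-suc (length (filter P? xs)) _) (cong suc (length-filter-¬ P? xs))

shift : ℤ → List ℤ → List ℤ
shift c = map (ℤ._+ c)

shift-unique : ∀ c {xs} → Unique xs → Unique (shift c xs)
shift-unique c = Unique.map⁺ (λ {x} {y} e → ℤ+.∙-cancelʳ c x y e)

card-translate : ∀ {xs ys x} → x ∈ xs → card ys ≤ card (xs ⊕ ys)
card-translate {xs} {ys} {x} x∈ = ≤-trans
  (≤-reflexive (sym (length-map (ℤ._+ x) (nub ys))))
  (unique⇒length≤card (shift-unique x (nub-unique ys)) (λ z∈ → case ∈-map⁻ _ z∈ of λ where
    (y , y∈ , refl) → subst (_∈ xs ⊕ ys) (ℤ.+-comm x y) (∈-⊕⁺ x∈ (∈-nub⁻ ys y∈))))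

module Petridis (A X : List ℤ) (uX : Unique X)
  (minimal : ∀ W → Unique W → W ⊆ X → card (X ⊕ A) * length W ≤ card (W ⊕ A) * length X) where

  open ≤-Reasoning

  private
    module Step (c : ℤ) (C : List ℤ) where

      returns? : Decidable (λ x → x ℤ.+ c ∈ X ⊕ C)
      returns? x = (x ℤ.+ c) ∈? (X ⊕ C)

      W = filter returns? X

      W⊆X : W ⊆ X
      W⊆X = proj₁ ∘ ∈-filter⁻ returns?

      -- By the definition of W, the translate by c of the rest of X is disjoint from X + C, so
      -- adding c to C gains at least |X| - |W| sums.
      lower : card (X ⊕ C) + length X ≤ card (X ⊕ (c ∷ C)) + length W
      lower = begin
        card (X ⊕ C) + length X              ≡⟨ cong (λ z → card (X ⊕ C) + z) (length-filter-¬ returns? X) ⟨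
        card (X ⊕ C) + (length W + length V) ≡⟨ rearrange (card (X ⊕ C)) (length W) (length V) ⟩
        card (X ⊕ C) + length V + length W   ≡⟨ cong (λ z → card (X ⊕ C) + z + length W) (length-map (ℤ._+ c) V) ⟨
        card (X ⊕ C) + length (shift c V) + length W ≡⟨ cong (_+ length W) (length-++ (nub (X ⊕ C))) ⟨
        length (nub (X ⊕ C) ++ shift c V) + length W
          ≤⟨ +-monoˡ-≤ (length W) (unique⇒length≤card
               (Unique.++⁺ (nub-unique (X ⊕ C)) (shift-unique c (Unique.filter⁺ (¬? ∘ returns?) uX)) disjoint) sub) ⟩
        card (X ⊕ (c ∷ C)) + length W ∎
        where
        V = filter (¬? ∘ returns?) X
        rearrange : ∀ p w v → p + (w + v) ≡ p + v + w
        rearrange = solve-∀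
        disjoint : ∀ {z} → z ∈ nub (X ⊕ C) × z ∈ shift c V → ⊥
        disjoint (z∈ , z∈′) with ∈-map⁻ (ℤ._+ c) z∈′
        ... | v , v∈ , refl = proj₂ (∈-filter⁻ (¬? ∘ returns?) {xs = X} v∈) (∈-nub⁻ (X ⊕ C) z∈)
        sub : nub (X ⊕ C) ++ shift c V ⊆ X ⊕ (c ∷ C)
        sub z∈ with ∈-++⁻ (nub (X ⊕ C)) z∈
        ... | inj₁ p = ⊕-mono {X} {ys = C} id there (∈-nub⁻ (X ⊕ C) p)
        ... | inj₂ p with ∈-map⁻ (ℤ._+ c) p
        ...   | v , v∈ , refl = ∈-⊕⁺ (proj₁ (∈-filter⁻ (¬? ∘ returns?) {xs = X} v∈)) (here refl)

      -- If w + c = x + e with e in C, then (w + a) + c = (x + a) + e. So W + A + c already lies in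
      -- X + A + C, and only the translate of the part of X + A outside W + A can be new.
      upper : card (X ⊕ A ⊕ (c ∷ C)) + card (W ⊕ A) ≤ card (X ⊕ A ⊕ C) + card (X ⊕ A)
      upper = begin
        card (X ⊕ A ⊕ (c ∷ C)) + card (W ⊕ A)
          ≤⟨ +-mono-≤ (card≤length (nub (X ⊕ A ⊕ C) ++ shift c V′) cover)
               (unique-⊆⇒length≤ (nub-unique (W ⊕ A)) back) ⟩
        length (nub (X ⊕ A ⊕ C) ++ shift c V′) + length V
          ≡⟨ cong (_+ length V) (trans (length-++ (nub (X ⊕ A ⊕ C))) (cong (λ z → card (X ⊕ A ⊕ C) + z) (length-map (ℤ._+ c) V′))) ⟩
        card (X ⊕ A ⊕ C) + length V′ + length V ≡⟨ rearrange (card (X ⊕ A ⊕ C)) (length V′) (length V) ⟩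
        card (X ⊕ A ⊕ C) + (length V + length V′) ≡⟨ cong (λ z → card (X ⊕ A ⊕ C) + z) (length-filter-¬ back? (nub (X ⊕ A))) ⟩
        card (X ⊕ A ⊕ C) + card (X ⊕ A) ∎
        where
        back? : Decidable (_∈ W ⊕ A)
        back? = _∈? (W ⊕ A)
        V = filter back? (nub (X ⊕ A))
        V′ = filter (¬? ∘ back?) (nub (X ⊕ A))
        rearrange : ∀ p w v → p + w + v ≡ p + (v + w)
        rearrange = solve-∀
        back : nub (W ⊕ A) ⊆ V
        back z∈ = let z∈′ = ∈-nub⁻ (W ⊕ A) z∈ in
          ∈-filter⁺ back? (∈-nub⁺ (⊕-mono W⊆X id z∈′)) z∈′
        cover : X ⊕ A ⊕ (c ∷ C) ⊆ nub (X ⊕ A ⊕ C) ++ shift c V′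
        cover z∈ with ∈-⊕⁻ (X ⊕ A) (c ∷ C) z∈
        ... | y , d , y∈ , there d∈ , refl = ∈-++⁺ˡ (∈-nub⁺ (∈-⊕⁺ y∈ d∈))
        ... | y , _ , y∈ , here refl , refl with back? y
        ...   | no y∉ = ∈-++⁺ʳ (nub (X ⊕ A ⊕ C)) (∈-map⁺ _ (∈-filter⁺ (¬? ∘ back?) (∈-nub⁺ y∈) y∉))
        ...   | yes y∈W with ∈-⊕⁻ W A y∈W
        ...     | w , a , w∈ , a∈ , refl with ∈-⊕⁻ X C (proj₂ (∈-filter⁻ returns? {xs = X} w∈))
        ...       | x , e , x∈ , e∈ , eq = ∈-++⁺ˡ (∈-nub⁺ (subst (_∈ X ⊕ A ⊕ C) (sym split) (∈-⊕⁺ (∈-⊕⁺ x∈ a∈) e∈)))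
          where
          swap : ∀ p q r → (p ℤ.+ q) ℤ.+ r ≡ (p ℤ.+ r) ℤ.+ q
          swap = ℤSolver.solve-∀
          split : w ℤ.+ a ℤ.+ c ≡ x ℤ.+ a ℤ.+ e
          split = trans (swap w a c) (trans (cong (ℤ._+ a) eq) (swap x e a))

  -- Petridis' lemma, by adding the elements of C one at a time. The two defects in `lower` and
  -- `upper` are |W| and |W + A|, and minimality of the ratio |X + A| / |X| is exactly what lets the
  -- second pay for the first.
  plünnecke-step : ∀ C → card (X ⊕ A ⊕ C) * length X ≤ card (X ⊕ A) * card (X ⊕ C)
  plünnecke-step [] = begin
    card (X ⊕ A ⊕ []) * length X ≤⟨ *-monoˡ-≤ (length X) (card≤length [] (λ z∈ → case ∈-⊕⁻ (X ⊕ A) [] z∈ of λ ())) ⟩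
    0                            ≤⟨ z≤n ⟩
    card (X ⊕ A) * card (X ⊕ []) ∎
  plünnecke-step (c ∷ C) = +-cancelʳ-≤ (v * p) (Q′ * p) (K * P′) (begin
    Q′ * p + v * p ≡⟨ *-distribʳ-+ p Q′ v ⟨
    (Q′ + v) * p   ≤⟨ *-monoˡ-≤ p upper ⟩
    (Q + K) * p    ≡⟨ *-distribʳ-+ p Q K ⟩
    Q * p + K * p  ≤⟨ +-monoˡ-≤ (K * p) (plünnecke-step C) ⟩
    K * P + K * p  ≡⟨ *-distribˡ-+ K P p ⟨
    K * (P + p)    ≤⟨ *-monoʳ-≤ K lower ⟩
    K * (P′ + w)   ≡⟨ *-distribˡ-+ K P′ w ⟩
    K * P′ + K * w ≤⟨ +-monoʳ-≤ (K * P′) (minimal W (Unique.filter⁺ returns? uX) W⊆X) ⟩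
    K * P′ + v * p ∎)
    where
    open Step c C
    p = length X
    w = length W
    v = card (W ⊕ A)
    K = card (X ⊕ A)
    P = card (X ⊕ C)
    P′ = card (X ⊕ (c ∷ C))
    Q = card (X ⊕ A ⊕ C)
    Q′ = card (X ⊕ A ⊕ (c ∷ C))

  -- Without denominators, |X + kA| ≤ (|X + A| / |X|)^k |X|; the previous lemma with C = kA
  -- contributes one factor of the ratio at each step.
  plünnecke-· : ∀ k → card (X ⊕ k · A) * length X ^ k ≤ card (X ⊕ A) ^ k * length X
  plünnecke-· zero = begin
    card (X ⊕ (+ 0 ∷ [])) * 1 ≡⟨ *-identityʳ _ ⟩
    card (X ⊕ (+ 0 ∷ []))     ≤⟨ card≤length (X ⊕ (+ 0 ∷ [])) id ⟩
    length (X ⊕ (+ 0 ∷ []))   ≡⟨ length-cartesianProductWith ℤ._+_ X (+ 0 ∷ []) ⟩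
    length X * 1              ≡⟨ *-comm (length X) 1 ⟩
    1 * length X              ∎
  plünnecke-· (suc k) = begin
    card (X ⊕ suc k · A) * (p * p ^ k)   ≤⟨ *-monoˡ-≤ (p * p ^ k) (card-mono assoc) ⟩
    card (X ⊕ A ⊕ k · A) * (p * p ^ k)   ≡⟨ *-assoc (card (X ⊕ A ⊕ k · A)) p (p ^ k) ⟨
    card (X ⊕ A ⊕ k · A) * p * p ^ k     ≤⟨ *-monoˡ-≤ (p ^ k) (plünnecke-step (k · A)) ⟩
    K * card (X ⊕ k · A) * p ^ k         ≡⟨ *-assoc K _ _ ⟩
    K * (card (X ⊕ k · A) * p ^ k)       ≤⟨ *-monoʳ-≤ K (plünnecke-· k) ⟩
    K * (K ^ k * p)                      ≡⟨ *-assoc K _ _ ⟨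
    K * K ^ k * p                        ∎
    where
    p = length X
    K = card (X ⊕ A)
    assoc : X ⊕ suc k · A ⊆ X ⊕ A ⊕ k · A
    assoc z∈ with ∈-⊕⁻ X (suc k · A) z∈
    ... | x , y , x∈ , y∈ , refl with ∈-⊕⁻ A (k · A) y∈
    ...   | a , b , a∈ , b∈ , refl = subst (_∈ X ⊕ A ⊕ k · A) (ℤ.+-assoc x a b) (∈-⊕⁺ (∈-⊕⁺ x∈ a∈) b∈)

-- Stability of the goal replaces the choice of a minimiser: a non-minimal X
-- yields a W with |W + A| < |X + A|, so descent on |X + A| terminates.
withMinimalRatio : ∀ A Y {G : Set} → Dec G → Unique Y → 0 < length Y →
  (∀ X → Unique X → X ⊆ Y → 0 < length X → card (X ⊕ A) * length Y ≤ card (Y ⊕ A) * length X →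
    (∀ W → Unique W → W ⊆ X → card (X ⊕ A) * length W ≤ card (W ⊕ A) * length X) → G) → G
withMinimalRatio A Y {G} G? uY Y≢∅ use = decidable-stable G? λ ¬G →
  descend ¬G (suc (card (Y ⊕ A))) Y ≤-refl uY id Y≢∅ ≤-refl
  where
  open ≤-Reasoning
  descend : ¬ G → ∀ n X → card (X ⊕ A) < n → Unique X → X ⊆ Y → 0 < length X →
    card (X ⊕ A) * length Y ≤ card (Y ⊕ A) * length X → ⊥
  descend ¬G (suc n) X (s≤s K≤n) uX X⊆Y X≢∅ ratio = ¬G (use X uX X⊆Y X≢∅ ratio minimal)
    where
    p = length X
    K = card (X ⊕ A)
    minimal : ∀ W → Unique W → W ⊆ X → K * length W ≤ card (W ⊕ A) * p
    minimal W uW W⊆X with K * length W ≤? card (W ⊕ A) * p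
    ... | yes le = le
    ... | no nle = ⊥-elim (descend ¬G n W (<-≤-trans smaller K≤n) uW (X⊆Y ∘ W⊆X) (W≢∅ W nle) ratio′)
      where
      w = length W
      v = card (W ⊕ A)
      lt : v * p < K * w
      lt = ≰⇒> nle
      W≢∅ : ∀ W → ¬ (K * length W ≤ card (W ⊕ A) * p) → 0 < length W
      W≢∅ [] f = ⊥-elim (f (≤-trans (≤-reflexive (*-zeroʳ K)) z≤n))
      W≢∅ (_ ∷ _) _ = s≤s z≤n
      smaller : v < K
      smaller = *-cancelʳ-< p v K (<-≤-trans lt (*-monoʳ-≤ K (unique-⊆⇒length≤ uW W⊆X)))
      instance
        p≢0 : NonZero p
        p≢0 = >-nonZero X≢∅
      ratio′ : v * length Y ≤ card (Y ⊕ A) * w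
      ratio′ = *-cancelʳ-≤ (v * length Y) (card (Y ⊕ A) * w) p (begin
        v * length Y * p        ≡⟨ swap v (length Y) p ⟩
        v * p * length Y        ≤⟨ *-monoˡ-≤ (length Y) (<⇒≤ lt) ⟩
        K * w * length Y        ≡⟨ swap K w (length Y) ⟩
        K * length Y * w        ≤⟨ *-monoˡ-≤ w ratio ⟩
        card (Y ⊕ A) * p * w    ≡⟨ swap (card (Y ⊕ A)) p w ⟩
        card (Y ⊕ A) * w * p    ∎)
        where
        swap : ∀ a b c → a * b * c ≡ a * c * b
        swap = solve-∀

-- Petridis' method starts from Y = -A, for which Y + A is A - A. A subset X of minimal ratio has |X
-- + A| / |X| ≤ |A - A| / |A|, hence |kA| ≤ |X + kA| ≤ (|A - A| / |A|)^k |X|, and |X| ≤ |A|.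
card-·-≤-differences : ∀ A j → 0 < card A → card (suc j · A) * card A ^ j ≤ card (A ⊖ A) ^ suc j
card-·-≤-differences A j A≢∅ = withMinimalRatio A Y (_ ≤? _) uY (subst (0 <_) (sym |Y|) A≢∅) bound
  where
  open ≤-Reasoning
  k = suc j
  a = card A
  N = card (A ⊖ A)
  L = card (k · A)
  Y = map ℤ.-_ (nub A)
  uY : Unique Y
  uY = Unique.map⁺ ℤ.neg-injective (nub-unique A)
  |Y| : length Y ≡ a
  |Y| = length-map ℤ.-_ (nub A)
  Y⊕A : card (Y ⊕ A) ≤ N
  Y⊕A = card-mono {Y ⊕ A} λ z∈ → case ∈-⊕⁻ Y A z∈ of λ where
    (y , b , y∈ , b∈ , refl) → case ∈-map⁻ ℤ.-_ y∈ of λ where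
      (x , x∈ , refl) → subst (_∈ A ⊖ A) (ℤ.+-comm b (ℤ.- x)) (∈-⊖⁺ b∈ (∈-nub⁻ A x∈))
  bound : ∀ X → Unique X → X ⊆ Y → 0 < length X → card (X ⊕ A) * length Y ≤ card (Y ⊕ A) * length X →
    (∀ W → Unique W → W ⊆ X → card (X ⊕ A) * length W ≤ card (W ⊕ A) * length X) → L * a ^ j ≤ N ^ k
  bound X uX X⊆Y X≢∅ ratio minimal = *-cancelʳ-≤ _ _ (a * p ^ k) (begin
    L * a ^ j * (a * p ^ k)              ≡⟨ e₁ L (a ^ j) a (p ^ k) ⟩
    L * p ^ k * a ^ k                    ≤⟨ *-monoˡ-≤ (a ^ k) (*-monoˡ-≤ (p ^ k) (card-translate {X} {k · A} (proj₂ (length>0⇒∈ {xs = X} X≢∅)))) ⟩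
    card (X ⊕ k · A) * p ^ k * a ^ k     ≤⟨ *-monoˡ-≤ (a ^ k) (plünnecke-· k) ⟩
    K ^ k * p * a ^ k                    ≡⟨ e₂ (K ^ k) p (a ^ k) ⟩
    K ^ k * a ^ k * p                    ≡⟨ cong (_* p) (^-distribʳ-* K a k) ⟨
    (K * a) ^ k * p                      ≤⟨ *-monoˡ-≤ p (^-monoˡ-≤ k ratio′) ⟩
    (N * p) ^ k * p                      ≡⟨ cong (_* p) (^-distribʳ-* N p k) ⟩
    N ^ k * p ^ k * p                    ≤⟨ *-monoʳ-≤ (N ^ k * p ^ k) (subst (p ≤_) |Y| (unique-⊆⇒length≤ uX X⊆Y)) ⟩
    N ^ k * p ^ k * a                    ≡⟨ e₃ (N ^ k) (p ^ k) a ⟩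
    N ^ k * (a * p ^ k)                  ∎)
    where
    open Petridis A X uX minimal
    p = length X
    K = card (X ⊕ A)
    instance
      a≢0 : NonZero a
      a≢0 = >-nonZero A≢∅
      p≢0 : NonZero p
      p≢0 = >-nonZero X≢∅
      pᵏ≢0 : NonZero (p ^ k)
      pᵏ≢0 = m^n≢0 p k
      ap≢0 : NonZero (a * p ^ k)
      ap≢0 = m*n≢0 a (p ^ k)
    ratio′ : K * a ≤ N * p
    ratio′ = ≤-trans (subst (λ z → K * z ≤ card (Y ⊕ A) * p) |Y| ratio) (*-monoˡ-≤ p Y⊕A)
    e₁ : ∀ l b c d → l * b * (c * d) ≡ l * d * (c * b)
    e₁ = solve-∀
    e₂ : ∀ b c d → b * c * d ≡ b * d * c
    e₂ = solve-∀
    e₃ : ∀ b c d → b * c * d ≡ b * (d * c)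
    e₃ = solve-∀

-- The lower bound in (a)

covers⇒inhabited : ∀ {k A q} → 1 ≤ k → 1 ≤ q → CoversInterval k A q → 0 < card A
covers⇒inhabited (s≤s _) 1≤q (_ , cov) with cov 1 ≤-refl 1≤q
... | x with InSumset⇒∈ x
covers⇒inhabited {suc k} {A} (s≤s _) 1≤q (_ , cov) | _ | x∈ with ∈-⊕⁻ A (k · A) x∈
... | _ , _ , a∈ , _ = card>0 a∈

-- The exponent 2k - 1 is split as (k - 1) + k. Bounding |kA|^(k-1) by |A|^(k(k-1)) produces the
-- power of |A| that, together with |kA|^k, forms the k-th power of |kA| |A|^(k-1), so |A|
-- disappears from the final bound.
beta-lower : ∀ k → 1 ≤ k → BetaAtLeast k (2 * k ∸ 1) (k * k)
beta-lower (suc j) 1≤k q 2≤q n (A , cov , dc) rewrite DiffCard⇒≡ dc = begin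
  -- With k = j + 1 the exponent `2 * k ∸ 1` computes to `j + (k + 0)`.
  q ^ (j + (k + 0))     ≤⟨ ^-monoˡ-≤ (j + (k + 0)) (covers⇒≤card {k} {A} cov) ⟩
  L ^ (j + (k + 0))     ≡⟨ cong (λ z → L ^ (j + z)) (+-identityʳ k) ⟩
  L ^ (j + k)           ≡⟨ ^-distribˡ-+-* L j k ⟩
  L ^ j * L ^ k         ≤⟨ *-monoˡ-≤ (L ^ k) (^-monoˡ-≤ j (card-· k A)) ⟩
  (a ^ k) ^ j * L ^ k   ≡⟨ cong (_* L ^ k) (trans (^-*-assoc a k j) (trans (cong (a ^_) (*-comm k j)) (sym (^-*-assoc a j k)))) ⟩
  (a ^ j) ^ k * L ^ k   ≡⟨ ^-distribʳ-* (a ^ j) L k ⟨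
  (a ^ j * L) ^ k       ≡⟨ cong (_^ k) (*-comm (a ^ j) L) ⟩
  (L * a ^ j) ^ k       ≤⟨ ^-monoˡ-≤ k (card-·-≤-differences A j (covers⇒inhabited 1≤k (<⇒≤ 2≤q) cov)) ⟩
  (N ^ k) ^ k           ≡⟨ ^-*-assoc N k k ⟩
  N ^ (k * k)           ∎
  where
  open ≤-Reasoning
  k = suc j
  a = card A
  N = card (A ⊖ A)
  L = card (k · A)

-- Loomis–Whitney and |(k+1)A|^k ≤ C |kA|^(k+1)

∑ : List 𝐴 → (𝐴 → ℕ) → ℕ
∑ xs f = sum (map f xs)

∑-mono : ∀ (xs : List 𝐴) {f g : 𝐴 → ℕ} → (∀ x → x ∈ xs → f x ≤ g x) → ∑ xs f ≤ ∑ xs g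
∑-mono [] _ = z≤n
∑-mono (x ∷ xs) le = +-mono-≤ (le x (here refl)) (∑-mono xs (λ y → le y ∘ there))

∑-cong : ∀ (xs : List 𝐴) {f g : 𝐴 → ℕ} → (∀ x → f x ≡ g x) → ∑ xs f ≡ ∑ xs g
∑-cong [] _ = refl
∑-cong (x ∷ xs) eq = cong₂ _+_ (eq x) (∑-cong xs eq)

∑-+ : ∀ (xs : List 𝐴) (f g : 𝐴 → ℕ) → ∑ xs (λ x → f x + g x) ≡ ∑ xs f + ∑ xs g
∑-+ [] f g = refl
∑-+ (x ∷ xs) f g = trans (cong (λ z → f x + g x + z) (∑-+ xs f g)) (rearrange (f x) (g x) (∑ xs f) (∑ xs g))
  where
  rearrange : ∀ a b c d → a + b + (c + d) ≡ a + c + (b + d)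
  rearrange = solve-∀

∑-*ˡ : ∀ (xs : List 𝐴) (c : ℕ) (f : 𝐴 → ℕ) → ∑ xs (λ x → c * f x) ≡ c * ∑ xs f
∑-*ˡ [] c f = sym (*-zeroʳ c)
∑-*ˡ (x ∷ xs) c f = trans (cong (λ z → c * f x + z) (∑-*ˡ xs c f)) (sym (*-distribˡ-+ c (f x) (∑ xs f)))

∑-const : ∀ (xs : List 𝐴) c → ∑ xs (λ _ → c) ≡ length xs * c
∑-const [] c = refl
∑-const (x ∷ xs) c = cong (λ z → c + z) (∑-const xs c)

∑-zero : ∀ (xs : List 𝐴) → ∑ xs (λ _ → 0) ≡ 0
∑-zero xs = trans (∑-const xs 0) (*-zeroʳ (length xs))

∑-swap : ∀ (xs : List 𝐴) (ys : List 𝐵) (f : 𝐴 → 𝐵 → ℕ) →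
  ∑ xs (λ x → ∑ ys (f x)) ≡ ∑ ys (λ y → ∑ xs (λ x → f x y))
∑-swap [] ys f = sym (∑-zero ys)
∑-swap (x ∷ xs) ys f = trans (cong (λ z → ∑ ys (f x) + z) (∑-swap xs ys f)) (sym (∑-+ ys (f x) _))

⟦_⟧ : {P : Set} → Dec P → ℕ
⟦ yes _ ⟧ = 1
⟦ no _ ⟧ = 0

⟦⟧≡1 : {P : Set} (d : Dec P) → P → ⟦ d ⟧ ≡ 1
⟦⟧≡1 (yes _) _ = refl
⟦⟧≡1 (no ¬p) p = ⊥-elim (¬p p)

∑-indicator : {P : Pred 𝐴 0ℓ} (P? : Decidable P) (xs : List 𝐴) → ∑ xs (λ x → ⟦ P? x ⟧) ≡ length (filter P? xs)
∑-indicator P? [] = refl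
∑-indicator P? (x ∷ xs) with P? x
... | yes _ = cong suc (∑-indicator P? xs)
... | no _ = ∑-indicator P? xs

∑-indicator-≥ : {P : Pred 𝐴 0ℓ} (P? : Decidable P) {xs ys : List 𝐴} →
  Unique ys → ys ⊆ xs → (∀ {y} → y ∈ ys → P y) → length ys ≤ ∑ xs (λ x → ⟦ P? x ⟧)
∑-indicator-≥ P? {xs} uys ys⊆xs Pys = ≤-trans
  (unique-⊆⇒length≤ uys (λ y∈ → ∈-filter⁺ P? (ys⊆xs y∈) (Pys y∈)))
  (≤-reflexive (sym (∑-indicator P? xs)))

∑-indicator-≤1 : {P : Pred 𝐴 0ℓ} (P? : Decidable P) {xs : List 𝐴} → Unique xs →
  (∀ {x y} → x ∈ xs → y ∈ xs → P x → P y → x ≡ y) → ∑ xs (λ x → ⟦ P? x ⟧) ≤ 1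
∑-indicator-≤1 {P = P} P? {xs} uxs same = ≤-trans (≤-reflexive (∑-indicator P? xs)) (go (filter P? xs) (Unique.filter⁺ P? uxs) (∈-filter⁻ P?))
  where
  go : ∀ ys → Unique ys → (∀ {y} → y ∈ ys → y ∈ xs × P y) → length ys ≤ 1
  go [] _ _ = z≤n
  go (_ ∷ []) _ _ = ≤-refl
  go (x ∷ y ∷ _) ((x≢y ∷ _) ∷ _) f with f (here refl) | f (there (here refl))
  ... | x∈ , px | y∈ , py = ⊥-elim (x≢y (same x∈ y∈ px py))

Tuple : ℕ → Set
Tuple = Vec ℤ

slice : ∀ {n} → ℤ → List (Tuple (suc n)) → List (Tuple n)
slice a [] = []
slice a ((b ∷ v) ∷ xs) with b ℤ.≟ a
... | yes _ = v ∷ slice a xs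
... | no _ = slice a xs

∈-slice⁺ : ∀ {n a} {v : Tuple n} {xs} → a ∷ v ∈ xs → v ∈ slice a xs
∈-slice⁺ {a = a} {xs = (b ∷ w) ∷ xs} v∈ with b ℤ.≟ a | v∈
... | yes _ | here refl = here refl
... | yes _ | there p = there (∈-slice⁺ p)
... | no b≢a | here refl = ⊥-elim (b≢a refl)
... | no _ | there p = ∈-slice⁺ p

∈-slice⁻ : ∀ {n a} {v : Tuple n} xs → v ∈ slice a xs → a ∷ v ∈ xs
∈-slice⁻ {a = a} ((b ∷ w) ∷ xs) v∈ with b ℤ.≟ a | v∈
... | yes refl | here refl = here refl
... | yes _ | there p = there (∈-slice⁻ xs p)
... | no _ | p = there (∈-slice⁻ xs p)

slice-unique : ∀ {n a} {xs : List (Tuple (suc n))} → Unique xs → Unique (slice a xs)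
slice-unique {xs = []} _ = []
slice-unique {a = a} {xs = (b ∷ v) ∷ xs} (v∉ ∷ uxs) with b ℤ.≟ a
... | yes refl = All.tabulate (λ { w∈ refl → All.lookup v∉ (∈-slice⁻ xs w∈) refl }) ∷ slice-unique uxs
... | no _ = slice-unique uxs

length-slice : ∀ {n} a b (v : Tuple n) xs → length (slice a ((b ∷ v) ∷ xs)) ≡ ⟦ b ℤ.≟ a ⟧ + length (slice a xs)
length-slice a b v xs with b ℤ.≟ a
... | yes _ = refl
... | no _ = refl

∑-slice-≤ : ∀ {n} {H : List ℤ} → Unique H → (xs : List (Tuple (suc n))) → ∑ H (λ a → length (slice a xs)) ≤ length xs
∑-slice-≤ {H = H} uH [] = ≤-reflexive (∑-zero H)
∑-slice-≤ {H = H} uH ((b ∷ v) ∷ xs) = begin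
  ∑ H (λ a → length (slice a ((b ∷ v) ∷ xs)))               ≡⟨ ∑-cong H (λ a → length-slice a b v xs) ⟩
  ∑ H (λ a → ⟦ b ℤ.≟ a ⟧ + length (slice a xs))             ≡⟨ ∑-+ H _ _ ⟩
  ∑ H (λ a → ⟦ b ℤ.≟ a ⟧) + ∑ H (λ a → length (slice a xs))
    ≤⟨ +-mono-≤ (∑-indicator-≤1 (b ℤ.≟_) uH (λ _ _ p q → trans (sym p) q)) (∑-slice-≤ uH xs) ⟩
  suc (length xs) ∎
  where open ≤-Reasoning

∑-slice-≥ : ∀ {n} {H : List ℤ} (xs : List (Tuple (suc n))) → (∀ {v} → v ∈ xs → Vec.head v ∈ H) →
  length xs ≤ ∑ H (λ a → length (slice a xs))
∑-slice-≥ [] _ = z≤n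
∑-slice-≥ {H = H} ((b ∷ v) ∷ xs) heads = begin
  suc (length xs)
    ≤⟨ +-mono-≤ (∑-indicator-≥ (b ℤ.≟_) {ys = b ∷ []} ([] ∷ []) (λ { (here refl) → heads (here refl) }) (λ { (here refl) → refl })) (∑-slice-≥ xs (heads ∘ there)) ⟩
  ∑ H (λ a → ⟦ b ℤ.≟ a ⟧) + ∑ H (λ a → length (slice a xs)) ≡⟨ ∑-+ H _ _ ⟨
  ∑ H (λ a → ⟦ b ℤ.≟ a ⟧ + length (slice a xs))             ≡⟨ ∑-cong H (λ a → length-slice a b v xs) ⟨
  ∑ H (λ a → length (slice a ((b ∷ v) ∷ xs)))               ∎
  where open ≤-Reasoning

-- Slice by the first coordinate.  Each slice of B injects into P, so if at most m slices
-- satisfied the hypothesis for n, B would be too small.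
loomis-whitney : ∀ n m (B : List (Tuple (suc n))) (P : List (Tuple n)) → Unique B →
  (∀ {v} → v ∈ B → ∀ i → removeAt v i ∈ P) → m * (suc n * length P) < length B → suc m ^ suc n ≤ length B
loomis-whitney zero m B P _ proj m<B = begin
  suc m * 1            ≡⟨ *-identityʳ (suc m) ⟩
  suc m                ≤⟨ s≤s (m≤m*n m (1 * length P) {{>-nonZero (P≢∅ B proj m<B)}}) ⟩
  suc (m * (1 * length P)) ≤⟨ m<B ⟩
  length B             ∎
  where
  open ≤-Reasoning
  P≢∅ : ∀ B → (∀ {v} → v ∈ B → ∀ i → removeAt v i ∈ P) → m * (1 * length P) < length B → 0 < 1 * length P
  P≢∅ (v ∷ B) proj _ = subst (0 <_) (sym (*-identityˡ (length P))) (∈-length (proj (here refl) zero))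
loomis-whitney (suc n) m B P uB proj m<B = begin
  suc m * M                          ≤⟨ *-monoˡ-≤ M m<G ⟩
  G * M                              ≡⟨ *-comm G M ⟩
  M * G                              ≡⟨ ∑-*ˡ H M _ ⟨
  ∑ H (λ a → M * ⟦ good? a ⟧)        ≤⟨ ∑-mono H large ⟩
  ∑ H (λ a → length (slice a B))     ≤⟨ ∑-slice-≤ uH B ⟩
  length B                           ∎
  where
  open ≤-Reasoning
  M = suc m ^ suc n
  H = nub (map Vec.head B)
  uH = nub-unique (map Vec.head B)
  good? = λ a → m * (suc n * length (slice a P)) <? length (slice a B)
  G = ∑ H (λ a → ⟦ good? a ⟧)
  p = length P

  slice-proj : ∀ a {v} → v ∈ slice a B → ∀ i → removeAt v i ∈ slice a P
  slice-proj a {_ ∷ _} v∈ i = ∈-slice⁺ (proj (∈-slice⁻ B v∈) (suc i))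

  large : ∀ a → a ∈ H → M * ⟦ good? a ⟧ ≤ length (slice a B)
  large a _ with good? a
  ... | yes lt = ≤-trans (≤-reflexive (*-identityʳ M))
    (loomis-whitney n m (slice a B) (slice a P) (slice-unique uB) (slice-proj a) lt)
  ... | no _ = ≤-trans (≤-reflexive (*-zeroʳ M)) z≤n

  -- The bad slices together contribute at most `m * suc n * p` and each good one at most `p`. As B
  -- exceeds `m * suc (suc n) * p`, the remaining `m * p` has to come from more than m good slices.
  small : ∀ a → a ∈ H → length (slice a B) ≤ m * suc n * length (slice a P) + p * ⟦ good? a ⟧
  small a _ with good? a
  ... | yes _ = begin
    length (slice a B) ≤⟨ unique-⊆⇒length≤ (slice-unique uB) (λ v∈ → proj (∈-slice⁻ B v∈) zero) ⟩
    p                  ≡⟨ *-identityʳ p ⟨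
    p * 1              ≤⟨ m≤n+m (p * 1) _ ⟩
    m * suc n * length (slice a P) + p * 1 ∎
  ... | no ¬lt = begin
    length (slice a B)                     ≤⟨ ≮⇒≥ ¬lt ⟩
    m * (suc n * length (slice a P))       ≡⟨ *-assoc m (suc n) _ ⟨
    m * suc n * length (slice a P)         ≤⟨ m≤m+n _ _ ⟩
    m * suc n * length (slice a P) + p * 0 ∎

  heads : ∀ {v} → v ∈ B → Vec.head v ∈ H
  heads v∈ = ∈-nub⁺ (∈-map⁺ Vec.head v∈)

  m<G : m < G
  m<G = *-cancelˡ-< p m G (+-cancelˡ-< (m * suc n * p) (p * m) (p * G) (begin-strict
    m * suc n * p + p * m                    ≡⟨ rearrange m n p ⟩
    m * (suc (suc n) * p)                    <⟨ m<B ⟩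
    length B                                 ≤⟨ ∑-slice-≥ B heads ⟩
    ∑ H (λ a → length (slice a B))           ≤⟨ ∑-mono H small ⟩
    ∑ H (λ a → m * suc n * length (slice a P) + p * ⟦ good? a ⟧)
      ≡⟨ trans (∑-+ H _ _) (cong₂ _+_ (∑-*ˡ H (m * suc n) _) (∑-*ˡ H p _)) ⟩
    m * suc n * ∑ H (λ a → length (slice a P)) + p * G
      ≤⟨ +-monoˡ-≤ (p * G) (*-monoʳ-≤ (m * suc n) (∑-slice-≤ uH P)) ⟩
    m * suc n * p + p * G                    ∎))
    where
    rearrange : ∀ m n p → m * suc n * p + p * m ≡ m * (suc (suc n) * p)
    rearrange = solve-∀

-- Lexicographically minimal representations

total : ∀ {n} → Tuple n → ℤ
total [] = + 0
total (x ∷ v) = x ℤ.+ total v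

infix 4 _≺_

_≺_ : ∀ {n} → Tuple n → Tuple n → Set
[] ≺ [] = ⊥
(x ∷ v) ≺ (y ∷ w) = x ℤ.< y ⊎ (x ≡ y × v ≺ w)

≺-connex : ∀ {n} (v w : Tuple n) → v ≡ w ⊎ v ≺ w ⊎ w ≺ v
≺-connex [] [] = inj₁ refl
≺-connex (x ∷ v) (y ∷ w) with ℤ.<-cmp x y
... | tri< lt _ _ = inj₂ (inj₁ (inj₁ lt))
... | tri> _ _ gt = inj₂ (inj₂ (inj₁ gt))
... | tri≈ _ refl _ with ≺-connex v w
...   | inj₁ refl = inj₁ refl
...   | inj₂ (inj₁ lt) = inj₂ (inj₁ (inj₂ (refl , lt)))
...   | inj₂ (inj₂ gt) = inj₂ (inj₂ (inj₂ (refl , gt)))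

total-removeAt : ∀ {n} (v : Tuple (suc n)) i → total v ≡ lookup v i ℤ.+ total (removeAt v i)
total-removeAt (x ∷ v) zero = refl
total-removeAt (x ∷ v@(_ ∷ _)) (suc i) = trans (cong (λ z → x ℤ.+ z) (total-removeAt v i)) (swap x (lookup v i) _)
  where
  swap : ∀ a b c → a ℤ.+ (b ℤ.+ c) ≡ b ℤ.+ (a ℤ.+ c)
  swap = ℤSolver.solve-∀

module Representations (A : List ℤ) where

  Over : ∀ {n} → Tuple n → Set
  Over = VecAll.All (_∈ A)

  LexMin : ∀ {n} → Tuple n → Set
  LexMin v = Over v × (∀ w → Over w → total w ≡ total v → ¬ w ≺ v)

  LexMin-injective : ∀ {n} {v w : Tuple n} → LexMin v → LexMin w → total v ≡ total w → v ≡ w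
  LexMin-injective {v = v} {w} (ov , mv) (ow , mw) eq with ≺-connex v w
  ... | inj₁ v≡w = v≡w
  ... | inj₂ (inj₁ v≺w) = ⊥-elim (mw v ov eq v≺w)
  ... | inj₂ (inj₂ w≺v) = ⊥-elim (mv w ow (sym eq) w≺v)

  Over-removeAt : ∀ {n} {v : Tuple (suc n)} → Over v → ∀ i → Over (removeAt v i)
  Over-removeAt (_ ∷ ov) zero = ov
  Over-removeAt {v = _ ∷ _ ∷ _} (o ∷ ov) (suc i) = o ∷ Over-removeAt ov i

  Over-lookup : ∀ {n} {v : Tuple n} → Over v → ∀ i → lookup v i ∈ A
  Over-lookup (o ∷ _) zero = o
  Over-lookup (_ ∷ ov) (suc i) = Over-lookup ov i

  -- A smaller w with the total of v minus its i-th entry extends to a smaller tuple with the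
  -- total of v; hence coordinate deletion preserves lexicographic minimality.
  improve : ∀ {n} (v : Tuple (suc n)) i (w : Tuple n) → Over v → Over w →
    total w ≡ total (removeAt v i) → w ≺ removeAt v i →
    ∃ λ (u : Tuple (suc n)) → Over u × total u ≡ total v × u ≺ v
  improve (x ∷ v) zero w (o ∷ _) ow eq lt = x ∷ w , o ∷ ow , cong (λ z → x ℤ.+ z) eq , inj₂ (refl , lt)
  -- The head already decides the comparison, so the deleted entry may be put back directly behind
  -- it.
  improve (x ∷ v@(_ ∷ _)) (suc i) (y ∷ w) (_ ∷ ov) (o ∷ ow) eq (inj₁ y<x) =
    y ∷ lookup v i ∷ w , o ∷ Over-lookup ov i ∷ ow , eq′ , inj₁ y<x
    where
    swap : ∀ a b c → a ℤ.+ (b ℤ.+ c) ≡ b ℤ.+ (a ℤ.+ c)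
    swap = ℤSolver.solve-∀
    eq′ : y ℤ.+ (lookup v i ℤ.+ total w) ≡ x ℤ.+ total v
    eq′ = trans (swap y (lookup v i) (total w)) (trans (cong (λ z → lookup v i ℤ.+ z) eq)
      (sym (total-removeAt (x ∷ v) (suc i))))
  improve (x ∷ v@(_ ∷ _)) (suc i) (.x ∷ w) (o ∷ ov) (_ ∷ ow) eq (inj₂ (refl , lt))
    with improve v i w ov ow (ℤ+.∙-cancelˡ x _ _ eq) lt
  ... | u , ou , equ , u≺v = x ∷ u , o ∷ ou , cong (λ z → x ℤ.+ z) equ , inj₂ (refl , u≺v)

  LexMin-removeAt : ∀ {n} {v : Tuple (suc n)} → LexMin v → ∀ i → LexMin (removeAt v i)
  LexMin-removeAt {v = v} (ov , mv) i = Over-removeAt ov i , λ w ow eq lt →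
    case improve v i w ov ow eq lt of λ where (u , ou , equ , u≺v) → mv u ou equ u≺v

  total∈ : ∀ {n} {v : Tuple n} → Over v → total v ∈ n · A
  total∈ [] = here refl
  total∈ (o ∷ ov) = ∈-⊕⁺ o (total∈ ov)

  minimum : {P : Pred ℤ 0ℓ} → Decidable P → (xs : List ℤ) → ∀ {x} → x ∈ xs → P x →
    ∃ λ a → a ∈ xs × P a × (∀ {b} → b ∈ xs → P b → ¬ b ℤ.< a)
  minimum {P} P? (y ∷ xs) x∈ px with any? P? xs
  ... | no none = least x∈ px
    where
    out : ∀ {b} → b ∈ xs → ¬ P b
    out b∈ pb = none (lose b∈ pb)
    least : ∀ {x} → x ∈ y ∷ xs → P x → ∃ λ a → a ∈ y ∷ xs × P a × (∀ {b} → b ∈ y ∷ xs → P b → ¬ b ℤ.< a)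
    least (there p) px = ⊥-elim (out p px)
    least (here refl) px = y , here refl , px , λ where
      (here refl) _ → ℤ.<-irrefl refl
      (there b∈) pb → ⊥-elim (out b∈ pb)
  ... | yes some with find some
  ...   | z , z∈ , pz with minimum P? xs z∈ pz
  ...     | a , a∈ , pa , mina with P? y ×-dec (y ℤ.<? a)
  ...       | yes (py , y<a) = y , here refl , py , λ where
    (here refl) _ → ℤ.<-irrefl refl
    (there b∈) pb b<y → mina b∈ pb (ℤ.<-trans b<y y<a)
  ...       | no ¬py = a , there a∈ , pa , λ where
    (here refl) pb b<a → ¬py (pb , b<a)
    (there b∈) pb → mina b∈ pb


  -- A greedy choice: the first entry is the least a in A with s - a still in nA, followed by a
  -- minimal representation of s - a. A smaller competitor would contradict the choice of a or the
  -- minimality of the tail.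
  represent : ∀ n {s} → s ∈ n · A → ∃ λ (v : Tuple n) → total v ≡ s × LexMin v
  represent zero (here refl) = [] , refl , [] , λ { [] _ _ () }
  represent (suc n) {s} s∈ with ∈-⊕⁻ A (n · A) s∈
  ... | x , y , x∈ , y∈ , refl
    with minimum (λ a → (s ℤ.- a) ∈? (n · A)) A x∈ (subst (_∈ n · A) (cancel x y) y∈)
    where
    cancel : ∀ x y → y ≡ x ℤ.+ y ℤ.- x
    cancel = ℤSolver.solve-∀
  ...   | a , a∈ , rest∈ , least with represent n rest∈
  ...     | v , eq , ov , mv = a ∷ v , totalEq , a∈ ∷ ov , λ where
      (b ∷ w) (b∈ ∷ ow) eqw (inj₁ b<a) →
        least b∈ (subst (_∈ n · A) (solveFor b (total w) (trans eqw totalEq)) (total∈ ow)) b<a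
      (.a ∷ w) (_ ∷ ow) eqw (inj₂ (refl , w≺v)) → mv w ow (ℤ+.∙-cancelˡ a _ _ eqw) w≺v
    where
    back : ∀ a s → a ℤ.+ (s ℤ.- a) ≡ s
    back = ℤSolver.solve-∀
    forth : ∀ b t → t ≡ b ℤ.+ t ℤ.- b
    forth = ℤSolver.solve-∀
    totalEq : a ℤ.+ total v ≡ s
    totalEq = trans (cong (λ z → a ℤ.+ z) eq) (back a s)
    solveFor : ∀ b t → b ℤ.+ t ≡ s → t ≡ s ℤ.- b
    solveFor b t e = trans (forth b t) (cong (ℤ._- b) e)

  -- The equality of lists, rather than of sets, transfers both the length and the distinctness of
  -- `xs` to the list of tuples.
  representAll : ∀ n xs → xs ⊆ n · A → ∃ λ (B : List (Tuple n)) → map total B ≡ xs × (∀ {v} → v ∈ B → LexMin v)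
  representAll n [] _ = [] , refl , λ ()
  representAll n (x ∷ xs) xs⊆ with represent n (xs⊆ (here refl)) | representAll n xs (xs⊆ ∘ there)
  ... | v , refl , mv | B , refl , mB = v ∷ B , refl , λ { (here refl) → mv ; (there v∈) → mB v∈ }

-- The minimal representations of (k+1)A form B, those of kA form P. Deleting any entry of a tuple
-- in B leaves a minimal tuple, hence an element of P, so the Loomis-Whitney inequality applies.
card-·-suc : ∀ k A → 0 < card A → card (suc k · A) ^ k ≤ (suc k * card (k · A)) ^ suc k
card-·-suc k A A≢∅ with representAll (suc k) (nub (suc k · A)) (∈-nub⁻ (suc k · A)) | representAll k (nub (k · A)) (∈-nub⁻ (k · A))
  where open Representations A
... | B , eqB , mB | P , eqP , mP = bound
  where
  open Representations A
  open ≤-Reasoning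
  b = card (suc k · A)
  p = card (k · A)
  c = suc k * p
  |B| : length B ≡ b
  |B| = trans (sym (length-map total B)) (cong length eqB)
  |P| : length P ≡ p
  |P| = trans (sym (length-map total P)) (cong length eqP)
  uB : Unique B
  uB = Unique.map⁻ (subst Unique (sym eqB) (nub-unique (suc k · A)))
  ∈-P : ∀ {w} → LexMin w → w ∈ P
  ∈-P {w} mw with ∈-map⁻ total (subst (total w ∈_) (sym eqP) (∈-nub⁺ (total∈ (proj₁ mw))))
  ... | v , v∈ , eq = subst (_∈ P) (sym (LexMin-injective mw (mP v∈) eq)) v∈
  sums-nonempty : ∀ j → 0 < card (j · A)
  sums-nonempty zero = s≤s z≤n
  sums-nonempty (suc j) = ≤-trans (sums-nonempty j) (card-translate {A} {j · A} (proj₂ (card>0⇒∈ {A} A≢∅)))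
  instance
    p≢0 : NonZero p
    p≢0 = >-nonZero (sums-nonempty k)
    b≢0 : NonZero b
    b≢0 = >-nonZero (sums-nonempty (suc k))
    c≢0 : NonZero c
    c≢0 = m*n≢0 (suc k) p
  -- The largest m with m c < b. Then b ≤ (m + 1) c, so b^(k+1) ≤ (m + 1)^(k+1) c^(k+1) ≤ b c^(k+1),
  -- and one factor b cancels.
  m = pred b / c
  mc<b : m * c < b
  mc<b = ≤-trans (s≤s (m/n*n≤m (pred b) c)) (≤-reflexive (suc-pred b))
  b≤[1+m]c : b ≤ suc m * c
  b≤[1+m]c = begin
    b                          ≡⟨ suc-pred b ⟨
    suc (pred b)               ≡⟨ cong suc (m≡m%n+[m/n]*n (pred b) c) ⟩
    suc (pred b % c + m * c)   ≤⟨ +-monoˡ-≤ (m * c) (m%n<n (pred b) c) ⟩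
    c + m * c                  ∎
  box : suc m ^ suc k ≤ b
  box = subst (suc m ^ suc k ≤_) |B| (loomis-whitney k m B P uB (λ v∈ i → ∈-P (LexMin-removeAt (mB v∈) i))
    (subst₂ _<_ (cong (λ z → m * (suc k * z)) (sym |P|)) (sym |B|) mc<b))
  bound : b ^ k ≤ c ^ suc k
  bound = *-cancelˡ-≤ b (begin
    b * b ^ k                  ≤⟨ ^-monoˡ-≤ (suc k) b≤[1+m]c ⟩
    (suc m * c) ^ suc k        ≡⟨ ^-distribʳ-* (suc m) c (suc k) ⟩
    suc m ^ suc k * c ^ suc k  ≤⟨ *-monoˡ-≤ (c ^ suc k) box ⟩
    b * c ^ suc k              ∎)

-- Random dilates modulo M and coverings by translates

^-swap : ∀ m n o → (m ^ n) ^ o ≡ (m ^ o) ^ n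
^-swap m n o = trans (^-*-assoc m n o) (trans (cong (m ^_) (*-comm n o)) (sym (^-*-assoc m o n)))

-- For b > 0 this is (1 + 1/b)^n ≥ 1 + n/b multiplied by b^(n+1).
bernoulli : ∀ b n → (b + n) * b ^ n ≤ b * suc b ^ n
bernoulli b zero = ≤-reflexive (cong (_* 1) (+-identityʳ b))
bernoulli b (suc n) = begin
  (b + suc n) * (b * b ^ n)      ≤⟨ m≤m+n _ _ ⟩
  (b + suc n) * (b * b ^ n) + n * b ^ n  ≡⟨ rearrange b n (b ^ n) ⟩
  suc b * ((b + n) * b ^ n)      ≤⟨ *-monoʳ-≤ (suc b) (bernoulli b n) ⟩
  suc b * (b * suc b ^ n)        ≡⟨ swap (suc b) b (suc b ^ n) ⟩
  b * (suc b * suc b ^ n)        ∎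
  where
  open ≤-Reasoning
  rearrange : ∀ b n z → (b + suc n) * (b * z) + n * z ≡ suc b * ((b + n) * z)
  rearrange = solve-∀
  swap : ∀ a b c → a * (b * c) ≡ b * (a * c)
  swap = solve-∀

-- Bernoulli to the power e + 1 at the exponent n (e + 1) beats the degree e in n.
exponential-beats-polynomial : ∀ a b C e → (∀ m → 1 ≤ m → a ^ m ≤ C * m ^ e * b ^ m) → a ≤ b
exponential-beats-polynomial a zero C e bound = begin
  a                     ≡⟨ *-identityʳ a ⟨
  a * 1                 ≤⟨ bound 1 ≤-refl ⟩
  C * 1 ^ e * 0         ≡⟨ *-zeroʳ (C * 1 ^ e) ⟩
  0                     ∎
  where open ≤-Reasoning
exponential-beats-polynomial a b@(suc _) C e bound = ≮⇒≥ λ b<a → <-irrefl refl (begin-strict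
  K              <⟨ n<1+n K ⟩
  suc K          ≤⟨ limit (suc K) b<a ⟩
  K              ∎)
  where
  open ≤-Reasoning
  r = suc e
  -- A bound for every positive n if b < a; the choice n = K + 1 refutes this.
  K = b ^ r * C * r ^ e
  limit : ∀ n .{{_ : NonZero n}} → b < a → n ≤ K
  limit n b<a = *-cancelʳ-≤ n K (n ^ e * b ^ (n * r)) (begin
    n * (n ^ e * b ^ (n * r))              ≡⟨ *-assoc n _ _ ⟨
    n ^ r * b ^ (n * r)                    ≡⟨ cong (n ^ r *_) (^-*-assoc b n r) ⟨
    n ^ r * (b ^ n) ^ r                    ≡⟨ ^-distribʳ-* n (b ^ n) r ⟨
    (n * b ^ n) ^ r                        ≤⟨ ^-monoˡ-≤ r (*-monoˡ-≤ (b ^ n) (m≤n+m n b)) ⟩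
    ((b + n) * b ^ n) ^ r                  ≤⟨ ^-monoˡ-≤ r (bernoulli b n) ⟩
    (b * suc b ^ n) ^ r                    ≡⟨ ^-distribʳ-* b (suc b ^ n) r ⟩
    b ^ r * (suc b ^ n) ^ r                ≤⟨ *-monoʳ-≤ (b ^ r) (^-monoˡ-≤ r (^-monoˡ-≤ n b<a)) ⟩
    b ^ r * (a ^ n) ^ r                    ≡⟨ cong (b ^ r *_) (^-*-assoc a n r) ⟩
    b ^ r * a ^ (n * r)                    ≤⟨ *-monoʳ-≤ (b ^ r) (bound (n * r) (>-nonZero⁻¹ (n * r) {{m*n≢0 n r}})) ⟩
    b ^ r * (C * (n * r) ^ e * b ^ (n * r)) ≡⟨ cong (λ z → b ^ r * (C * z * b ^ (n * r))) (^-distribʳ-* n r e) ⟩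
    b ^ r * (C * (n ^ e * r ^ e) * b ^ (n * r)) ≡⟨ rearrange (b ^ r) C (n ^ e) (r ^ e) (b ^ (n * r)) ⟩
    K * (n ^ e * b ^ (n * r))              ∎)
    where
    instance
      nz : NonZero (n ^ e * b ^ (n * r))
      nz = m*n≢0 (n ^ e) _ {{m^n≢0 n e}} {{m^n≢0 b (n * r)}}
    rearrange : ∀ x c y z w → x * (c * (y * z) * w) ≡ x * c * z * (y * w)
    rearrange = solve-∀

averageMin : ∀ (Λ : List 𝐴) (f : 𝐴 → ℕ) → 0 < length Λ → ∃ λ x → x ∈ Λ × length Λ * f x ≤ ∑ Λ f
averageMin (x ∷ []) f _ = x , here refl , ≤-refl
averageMin (x ∷ Λ@(_ ∷ _)) f _ with averageMin Λ f (s≤s z≤n)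
... | y , y∈ , le with f x ≤? f y
...   | yes fx≤fy = x , here refl , +-monoʳ-≤ (f x) (≤-trans (*-monoʳ-≤ (length Λ) fx≤fy) le)
...   | no fx≰fy = y , there y∈ , +-mono-≤ (≰⇒≥ fx≰fy) le

averageMax : ∀ (Λ : List 𝐴) (f : 𝐴 → ℕ) → 0 < length Λ → ∃ λ x → x ∈ Λ × ∑ Λ f ≤ length Λ * f x
averageMax (x ∷ []) f _ = x , here refl , ≤-refl
averageMax (x ∷ Λ@(_ ∷ _)) f _ with averageMax Λ f (s≤s z≤n)
... | y , y∈ , le with f x ≤? f y
...   | yes fx≤fy = y , there y∈ , +-mono-≤ fx≤fy le
...   | no fx≰fy = x , here refl , +-monoʳ-≤ (f x) (≤-trans le (*-monoʳ-≤ (length Λ) (≰⇒≥ fx≰fy)))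

module Collisions {R : ℕ → 𝐴 → 𝐴 → Set} (R? : ∀ l w w′ → Dec (R l w w′)) where

  collisions : ℕ → List 𝐴 → ℕ
  collisions l [] = 0
  collisions l (w ∷ ws) = ∑ ws (λ w′ → ⟦ R? l w w′ ⟧) + collisions l ws

  -- The deletion method: an element is dropped when it collides with a later one, and that
  -- collision pays for the loss.
  thin : ∀ l ws → ∃ λ ys → ys ⊆ ws × AllPairs (λ w w′ → ¬ R l w w′) ys × length ws ≤ length ys + collisions l ws
  thin l [] = [] , id , [] , z≤n
  thin l (w ∷ ws) with thin l ws | any? (R? l w) ws
  ... | ys , ys⊆ , apart , le | yes hit with find hit
  ...   | w′ , w′∈ , r = ys , there ∘ ys⊆ , apart , (begin
    suc (length ws)                                  ≤⟨ +-mono-≤ one le ⟩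
    c + (length ys + collisions l ws)                ≡⟨ swap c (length ys) (collisions l ws) ⟩
    length ys + (c + collisions l ws)                ∎)
    where
    open ≤-Reasoning
    c = ∑ ws (λ w′ → ⟦ R? l w w′ ⟧)
    one : 1 ≤ c
    one = ∑-indicator-≥ (R? l w) {ys = w′ ∷ []} ([] ∷ []) (λ { (here refl) → w′∈ }) (λ { (here refl) → r })
    swap : ∀ a b c → a + (b + c) ≡ b + (a + c)
    swap = solve-∀
  thin l (w ∷ ws) | ys , ys⊆ , apart , le | no miss =
    w ∷ ys , (λ { (here p) → here p ; (there p) → there (ys⊆ p) }) ,
    All.tabulate (λ y∈ r → miss (lose (ys⊆ y∈) r)) ∷ apart ,
    s≤s (≤-trans le (+-monoʳ-≤ (length ys) (m≤n+m _ _)))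

  -- Double counting: each of the at most |ws|² pairs collides for at most one parameter.
  ∑-collisions : ∀ Λ ws → Unique ws →
    (∀ {w w′} → w ∈ ws → w′ ∈ ws → w ≢ w′ → ∑ Λ (λ l → ⟦ R? l w w′ ⟧) ≤ 1) →
    ∑ Λ (λ l → collisions l ws) ≤ length ws * length ws
  ∑-collisions Λ [] _ _ = ≤-reflexive (∑-zero Λ)
  ∑-collisions Λ (w ∷ ws) (w∉ ∷ uws) once = begin
    ∑ Λ (λ l → ∑ ws (λ w′ → ⟦ R? l w w′ ⟧) + collisions l ws)
      ≡⟨ ∑-+ Λ _ _ ⟩
    ∑ Λ (λ l → ∑ ws (λ w′ → ⟦ R? l w w′ ⟧)) + ∑ Λ (λ l → collisions l ws)
      ≤⟨ +-mono-≤ first (∑-collisions Λ ws uws (λ p q → once (there p) (there q))) ⟩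
    n + n * n       ≤⟨ *-monoʳ-≤ (suc n) (n≤1+n n) ⟩
    suc n * suc n   ∎
    where
    open ≤-Reasoning
    n = length ws
    first : ∑ Λ (λ l → ∑ ws (λ w′ → ⟦ R? l w w′ ⟧)) ≤ n
    first = begin
      ∑ Λ (λ l → ∑ ws (λ w′ → ⟦ R? l w w′ ⟧)) ≡⟨ ∑-swap Λ ws _ ⟩
      ∑ ws (λ w′ → ∑ Λ (λ l → ⟦ R? l w w′ ⟧)) ≤⟨ ∑-mono ws (λ w′ w′∈ → once (here refl) (there w′∈) (All.lookup w∉ w′∈)) ⟩
      ∑ ws (λ _ → 1)                          ≡⟨ trans (∑-const ws 1) (*-identityʳ n) ⟩
      n                                       ∎

  -- The random choice made deterministic: some parameter has at most the average number |ws|² / |Λ|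
  -- of collisions.
  fewCollisions : ∀ Λ ws → 0 < length Λ → Unique ws →
    (∀ {w w′} → w ∈ ws → w′ ∈ ws → w ≢ w′ → ∑ Λ (λ l → ⟦ R? l w w′ ⟧) ≤ 1) →
    ∃₂ λ l ys → ys ⊆ ws × AllPairs (λ w w′ → ¬ R l w w′) ys ×
      length Λ * length ws ≤ length Λ * length ys + length ws * length ws
  fewCollisions Λ ws Λ≢∅ uws once with averageMin Λ (λ l → collisions l ws) Λ≢∅
  ... | l , _ , avg with thin l ws
  ...   | ys , ys⊆ , apart , le = l , ys , ys⊆ , apart , (begin
    M * length ws                              ≤⟨ *-monoʳ-≤ M le ⟩
    M * (length ys + collisions l ws)          ≡⟨ *-distribˡ-+ M _ _ ⟩
    M * length ys + M * collisions l ws        ≤⟨ +-monoʳ-≤ (M * length ys) (≤-trans avg (∑-collisions Λ ws uws once)) ⟩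
    M * length ys + length ws * length ws      ∎)
    where
    open ≤-Reasoning
    M = length Λ

-- Residue classes modulo M

module Modular (M : ℕ) {{_ : NonZero M}} where

  infix 4 _≈_ _≈?_

  record _≈_ (x y : ℤ) : Set where
    constructor congruent
    field divisible : + M ℤ∣.∣ x ℤ.- y
  open _≈_ public

  _≈?_ : ∀ x y → Dec (x ≈ y)
  x ≈? y = map′ congruent divisible (+ M ℤ∣.∣? (x ℤ.- y))

  ≈-by : ∀ {x y} q → x ≡ y ℤ.+ q ℤ.* + M → x ≈ y
  ≈-by {y = y} q refl = congruent (ℤ∣.divides q (cancel y (q ℤ.* + M)))
    where
    cancel : ∀ y z → y ℤ.+ z ℤ.- y ≡ z
    cancel = ℤSolver.solve-∀

  ≈-refl : ∀ {x} → x ≈ x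
  ≈-refl {x} = ≈-by (+ 0) (sym (ℤ.+-identityʳ x))

  ≈-sym : ∀ {x y} → x ≈ y → y ≈ x
  ≈-sym {x} {y} (congruent d) = congruent (subst (+ M ℤ∣.∣_) (flip x y) (ℤ∣.∣m⇒∣-m d))
    where
    flip : ∀ x y → ℤ.- (x ℤ.- y) ≡ y ℤ.- x
    flip = ℤSolver.solve-∀

  ≈-trans : ∀ {x y z} → x ≈ y → y ≈ z → x ≈ z
  ≈-trans {x} {y} {z} (congruent d) (congruent e) = congruent (subst (+ M ℤ∣.∣_) (join x y z) (ℤ∣.∣m∣n⇒∣m+n d e))
    where
    join : ∀ x y z → (x ℤ.- y) ℤ.+ (y ℤ.- z) ≡ x ℤ.- z
    join = ℤSolver.solve-∀

  ≈-+ : ∀ {x y z w} → x ≈ y → z ≈ w → x ℤ.+ z ≈ y ℤ.+ w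
  ≈-+ {x} {y} {z} {w} (congruent d) (congruent e) = congruent (subst (+ M ℤ∣.∣_) (join x y z w) (ℤ∣.∣m∣n⇒∣m+n d e))
    where
    join : ∀ x y z w → (x ℤ.- y) ℤ.+ (z ℤ.- w) ≡ x ℤ.+ z ℤ.- (y ℤ.+ w)
    join = ℤSolver.solve-∀

  ≈-neg : ∀ {x y} → x ≈ y → ℤ.- x ≈ ℤ.- y
  ≈-neg {x} {y} (congruent d) = congruent (subst (+ M ℤ∣.∣_) (flip x y) (ℤ∣.∣m⇒∣-m d))
    where
    flip : ∀ x y → ℤ.- (x ℤ.- y) ≡ ℤ.- x ℤ.- ℤ.- y
    flip = ℤSolver.solve-∀

  residue : ℤ → ℕ
  residue x = x %ℕ M

  residue< : ∀ x → residue x < M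
  residue< x = n%ℕd<d x M

  residue≈ : ∀ x → + residue x ≈ x
  residue≈ x = ≈-sym (≈-by (x /ℕ M) (a≡a%ℕn+[a/ℕn]*n x M))

  residue≡⇒≈ : ∀ {x y} → residue x ≡ residue y → x ≈ y
  residue≡⇒≈ {x} {y} e = ≈-trans (≈-sym (residue≈ x)) (subst (λ r → + r ≈ y) (sym e) (residue≈ y))

  ≈⇒≡ : ∀ {a b} → a < M → b < M → + a ≈ + b → a ≡ b
  ≈⇒≡ {a} {b} a<M b<M (congruent d) = ℤ.+-injective (ℤ.i-j≡0⇒i≡j (+ a) (+ b) (ℤ.∣i∣≡0⇒i≡0 zeroAbs))
    where
    small : ℤ.∣ + a ℤ.- + b ∣ < M
    small = ≤-<-trans (subst (λ z → ℤ.∣ z ∣ ≤ a ⊔ b) (sym (ℤ.[+m]-[+n]≡m⊖n a b)) (ℤ.∣m⊝n∣≤m⊔n a b)) (⊔-lub a<M b<M)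
    zeroAbs : ℤ.∣ + a ℤ.- + b ∣ ≡ 0
    zeroAbs with ℤ.∣ + a ℤ.- + b ∣ | small | ℤ∣.∣⇒∣ᵤ d
    ... | zero | _ | _ = refl
    ... | suc n | lt | M∣ = ⊥-elim (ℕ∣.>⇒∤ lt M∣)

  Incongruent : List ℤ → Set
  Incongruent = AllPairs (λ x y → ¬ x ≈ y)

  Incongruent⇒Unique : ∀ {xs} → Incongruent xs → Unique xs
  Incongruent⇒Unique = AllPairs.map (λ { x≉y refl → x≉y ≈-refl })

  Incongruent-≢ : ∀ {xs x y} → Incongruent xs → x ∈ xs → y ∈ xs → x ≢ y → ¬ x ≈ y
  Incongruent-≢ inc x∈ y∈ x≢y x≈y with ∈-AllPairs₂ inc x∈ y∈
  ... | inj₁ x≡y = x≢y x≡y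
  ... | inj₂ (inj₁ x≉y) = x≉y x≈y
  ... | inj₂ (inj₂ y≉x) = y≉x (≈-sym x≈y)

  -- Differences of distinct elements of S are invertible modulo M, expressed as the cancellation
  -- property.
  Separated : List ℤ → Set
  Separated S = ∀ {s s′} → s ∈ S → s′ ∈ S → s ≢ s′ → ∀ z → + M ℤ∣.∣ z ℤ.* (s ℤ.- s′) → + M ℤ∣.∣ z

  -- Two distinct pairs (x , s) collide under x + c s for at most one residue c.
  spread : ∀ X S → Incongruent X → Unique S → Separated S → ∃₂ λ (c : ℤ) Y →
    (∀ {y} → y ∈ Y → ∃₂ λ x s → x ∈ X × s ∈ S × y ≡ x ℤ.+ c ℤ.* s) × Incongruent Y ×
    M * (length X * length S) ≤ M * length Y + (length X * length S) * (length X * length S)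
  spread X S incX uS sepS with fewCollisions (upTo M) W (subst (0 <_) (sym (length-upTo M)) (>-nonZero⁻¹ M)) uW once
    where
    val : ℕ → ℤ × ℤ → ℤ
    val l (x , s) = x ℤ.+ + l ℤ.* s
    open Collisions (λ l w w′ → val l w ≈? val l w′)
    W = cartesianProduct X S
    uW = Unique.cartesianProduct⁺ (Incongruent⇒Unique incX) uS
    once : ∀ {w w′} → w ∈ W → w′ ∈ W → w ≢ w′ → ∑ (upTo M) (λ l → ⟦ val l w ≈? val l w′ ⟧) ≤ 1
    once {x , s} {x′ , s′} w∈ w′∈ w≢w′ = ∑-indicator-≤1 (λ l → val l (x , s) ≈? val l (x′ , s′)) (Unique.upTo⁺ M) same
      where
      x∈ = proj₁ (∈-cartesianProduct⁻ X S w∈)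
      s∈ = proj₂ (∈-cartesianProduct⁻ X S w∈)
      x′∈ = proj₁ (∈-cartesianProduct⁻ X S w′∈)
      s′∈ = proj₂ (∈-cartesianProduct⁻ X S w′∈)
      same : ∀ {l m} → l ∈ upTo M → m ∈ upTo M → val l (x , s) ≈ val l (x′ , s′) → val m (x , s) ≈ val m (x′ , s′) → l ≡ m
      same {l} {m} l∈ m∈ p q with s ℤ.≟ s′
      ... | yes refl = ⊥-elim (Incongruent-≢ incX x∈ x′∈ (λ { refl → w≢w′ refl })
              (congruent (subst (+ M ℤ∣.∣_) (cancel x x′ (+ l ℤ.* s)) (divisible p))))
        where
        cancel : ∀ x y z → (x ℤ.+ z) ℤ.- (y ℤ.+ z) ≡ x ℤ.- y
        cancel = ℤSolver.solve-∀
      -- Subtracting the two congruences eliminates x and x′ and leaves (l - m)(s - s′), whose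
      -- second factor can be cancelled modulo M.
      ... | no s≢s′ = ≈⇒≡ (∈-upTo⁻ l∈) (∈-upTo⁻ m∈) (congruent (sepS s∈ s′∈ s≢s′ (+ l ℤ.- + m)
              (subst (+ M ℤ∣.∣_) (eliminate x x′ s s′ (+ l) (+ m)) (ℤ∣.∣m∣n⇒∣m-n (divisible p) (divisible q)))))
        where
        eliminate : ∀ x x′ s s′ l m →
          ((x ℤ.+ l ℤ.* s) ℤ.- (x′ ℤ.+ l ℤ.* s′)) ℤ.- ((x ℤ.+ m ℤ.* s) ℤ.- (x′ ℤ.+ m ℤ.* s′)) ≡ (l ℤ.- m) ℤ.* (s ℤ.- s′)
        eliminate = ℤSolver.solve-∀
  ... | l , ys , ys⊆ , apart , le = + l , map val ys ,
    (λ y∈ → case ∈-map⁻ val y∈ of λ where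
      ((x , s) , w∈ , refl) → x , s , proj₁ (∈-cartesianProduct⁻ X S (ys⊆ w∈)) , proj₂ (∈-cartesianProduct⁻ X S (ys⊆ w∈)) , refl) ,
    AllPairs.map⁺ apart ,
    subst₂ _≤_ (cong₂ _*_ (length-upTo M) |W|)
      (cong₂ _+_ (cong₂ _*_ (length-upTo M) (sym (length-map val ys))) (cong₂ _*_ |W| |W|)) le
    where
    val : ℤ × ℤ → ℤ
    val (x , s) = x ℤ.+ + l ℤ.* s
    |W| = length-cartesianProductWith _,_ X S

  module Cover (X : List ℤ) (incX : Incongruent X) (d : ℕ) (dense : M ≤ suc d * length X) where
    open ≤-Reasoning

    Hit : ℕ → ℕ → Set
    Hit u t = ∃ λ x → x ∈ X × + u ≈ x ℤ.+ + t

    hit? : ∀ u t → Dec (Hit u t)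
    hit? u t = map′ find (λ (_ , x∈ , p) → lose x∈ p) (any? (λ x → + u ≈? x ℤ.+ + t) X)

    -- The shifts that carry some x to u are the residues of u - x, which are distinct because the
    -- elements of X are incongruent.
    hits : ∀ u → length X ≤ ∑ (upTo M) (λ t → ⟦ hit? u t ⟧)
    hits u = subst (_≤ ∑ (upTo M) (λ t → ⟦ hit? u t ⟧)) (length-map gap X) (∑-indicator-≥ (hit? u)
      (AllPairs.map⁺ (AllPairs.map (λ {x} {y} x≉y e → x≉y (gap≡⇒≈ x y e)) incX))
      (λ t∈ → case ∈-map⁻ gap t∈ of λ where (x , x∈ , refl) → ∈-upTo⁺ (residue< (+ u ℤ.- x)))
      (λ t∈ → case ∈-map⁻ gap t∈ of λ where (x , x∈ , refl) → x , x∈ , gap-hit x))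
      where
      gap : ℤ → ℕ
      gap x = residue (+ u ℤ.- x)
      undo : ∀ a b → b ℤ.+ (a ℤ.- b) ≡ a
      undo = ℤSolver.solve-∀
      flip : ∀ a x → a ℤ.+ ℤ.- (a ℤ.- x) ≡ x
      flip = ℤSolver.solve-∀
      gap-hit : ∀ x → + u ≈ x ℤ.+ + gap x
      gap-hit x = ≈-sym (subst (x ℤ.+ + gap x ≈_) (undo (+ u) x) (≈-+ (≈-refl {x}) (residue≈ (+ u ℤ.- x))))
      gap≡⇒≈ : ∀ x y → gap x ≡ gap y → x ≈ y
      gap≡⇒≈ x y e = subst₂ _≈_ (flip (+ u) x) (flip (+ u) y)
        (≈-+ (≈-refl {+ u}) (≈-neg (residue≡⇒≈ {+ u ℤ.- x} {+ u ℤ.- y} e)))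

    -- On average over all shifts, a translate of X hits a proportion |X| / M ≥ 1/(d+1) of the
    -- uncovered set U. The best shift does at least as well, so each step leaves at most the
    -- fraction d/(d+1) of U.
    greedy : ∀ j → ∃₂ λ (T U : List ℕ) → length T ≡ j × suc d ^ j * length U ≤ d ^ j * M ×
      (∀ u → u < M → u ∈ U ⊎ ∃ λ t → t ∈ T × Hit u t)
    greedy zero = [] , upTo M , refl , ≤-reflexive (cong (1 *_) (length-upTo M)) , λ u u<M → inj₁ (∈-upTo⁺ u<M)
    greedy (suc j) with greedy j
    ... | T , U , |T| , shrink , cover
      with averageMax (upTo M) (λ t → ∑ U (λ u → ⟦ hit? u t ⟧)) (subst (0 <_) (sym (length-upTo M)) (>-nonZero⁻¹ M))
    ...   | t , _ , avg = t ∷ T , U′ , cong suc |T| , shrink′ , cover′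
      where
      U′ = filter (λ u → ¬? (hit? u t)) U
      h = length (filter (λ u → hit? u t) U)
      many : length U * length X ≤ M * h
      many = begin
        length U * length X                              ≡⟨ ∑-const U (length X) ⟨
        ∑ U (λ _ → length X)                             ≤⟨ ∑-mono U (λ u _ → hits u) ⟩
        ∑ U (λ u → ∑ (upTo M) (λ t → ⟦ hit? u t ⟧))      ≡⟨ ∑-swap U (upTo M) _ ⟩
        ∑ (upTo M) (λ t → ∑ U (λ u → ⟦ hit? u t ⟧))      ≤⟨ avg ⟩
        length (upTo M) * ∑ U (λ u → ⟦ hit? u t ⟧)       ≡⟨ cong₂ _*_ (length-upTo M) (∑-indicator (λ u → hit? u t) U) ⟩
        M * h                                            ∎
      fraction : length U ≤ suc d * h
      fraction = *-cancelˡ-≤ M (begin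
        M * length U                       ≤⟨ *-monoˡ-≤ (length U) dense ⟩
        suc d * length X * length U        ≡⟨ swap (suc d) (length X) (length U) ⟩
        suc d * (length U * length X)      ≤⟨ *-monoʳ-≤ (suc d) many ⟩
        suc d * (M * h)                    ≡⟨ swap′ (suc d) M h ⟩
        M * (suc d * h)                    ∎)
        where
        swap : ∀ a b c → a * b * c ≡ a * (c * b)
        swap = solve-∀
        swap′ : ∀ a b c → a * (b * c) ≡ b * (a * c)
        swap′ = solve-∀
      shrinkOnce : suc d * length U′ ≤ d * length U
      shrinkOnce = +-cancelˡ-≤ (length U) _ _ (begin
        length U + suc d * length U′       ≤⟨ +-monoˡ-≤ (suc d * length U′) fraction ⟩
        suc d * h + suc d * length U′      ≡⟨ *-distribˡ-+ (suc d) h (length U′) ⟨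
        suc d * (h + length U′)            ≡⟨ cong (suc d *_) (length-filter-¬ (λ u → hit? u t) U) ⟩
        suc d * length U                   ∎)
      shrink′ : suc d * suc d ^ j * length U′ ≤ d * d ^ j * M
      shrink′ = begin
        suc d * suc d ^ j * length U′      ≡⟨ swap (suc d) (suc d ^ j) (length U′) ⟩
        suc d ^ j * (suc d * length U′)    ≤⟨ *-monoʳ-≤ (suc d ^ j) shrinkOnce ⟩
        suc d ^ j * (d * length U)         ≡⟨ swap′ (suc d ^ j) d (length U) ⟩
        d * (suc d ^ j * length U)         ≤⟨ *-monoʳ-≤ d shrink ⟩
        d * (d ^ j * M)                    ≡⟨ *-assoc d _ _ ⟨
        d * d ^ j * M                      ∎
        where
        swap : ∀ a b c → a * b * c ≡ b * (a * c)
        swap = solve-∀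
        swap′ : ∀ a b c → a * (b * c) ≡ b * (a * c)
        swap′ = solve-∀
      cover′ : ∀ u → u < M → u ∈ U′ ⊎ ∃ λ s → s ∈ t ∷ T × Hit u s
      cover′ u u<M with cover u u<M | hit? u t
      ... | _ | yes p = inj₂ (t , here refl , p)
      ... | inj₁ u∈ | no ¬p = inj₁ (∈-filter⁺ (λ u → ¬? (hit? u t)) u∈ ¬p)
      ... | inj₂ (s , s∈ , p) | no _ = inj₂ (s , there s∈ , p)

    -- Bernoulli gives (1 + 1/d)^(d+1) ≥ 2: every d + 1 greedy steps at least halve the uncovered
    -- set.
    double : .{{_ : NonZero d}} → 2 * d ^ suc d ≤ suc d ^ suc d
    double = *-cancelˡ-≤ d (begin
      d * (2 * d ^ suc d)          ≡⟨ swap d (d ^ suc d) ⟩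
      (d + d) * d ^ suc d          ≤⟨ *-monoˡ-≤ (d ^ suc d) (+-monoʳ-≤ d (n≤1+n d)) ⟩
      (d + suc d) * d ^ suc d      ≤⟨ bernoulli d (suc d) ⟩
      d * suc d ^ suc d            ∎)
      where
      swap : ∀ a b → a * (2 * b) ≡ (a + a) * b
      swap = solve-∀

    -- After e halvings at most M / 2^e < 1 residues are uncovered, hence none.
    cover : .{{_ : NonZero d}} → ∀ e → M < 2 ^ e → ∃ λ (T : List ℕ) → length T ≡ suc d * e ×
      (∀ u → u < M → ∃ λ t → t ∈ T × Hit u t)
    cover e M<2^e with greedy (suc d * e)
    ... | T , (u ∷ U) , |T| , shrink , _ = ⊥-elim (<-irrefl refl (begin-strict
      d ^ n * M           <⟨ *-monoʳ-< (d ^ n) {{m^n≢0 d n}} M<2^e ⟩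
      d ^ n * 2 ^ e       ≡⟨ cong (_* 2 ^ e) (^-*-assoc d (suc d) e) ⟨
      (d ^ suc d) ^ e * 2 ^ e ≡⟨ ^-distribʳ-* (d ^ suc d) 2 e ⟨
      (d ^ suc d * 2) ^ e ≤⟨ ^-monoˡ-≤ e (≤-trans (≤-reflexive (*-comm (d ^ suc d) 2)) double) ⟩
      (suc d ^ suc d) ^ e ≡⟨ ^-*-assoc (suc d) (suc d) e ⟩
      suc d ^ n           ≤⟨ m≤m*n (suc d ^ n) (suc (length U)) ⟩
      suc d ^ n * suc (length U) ≤⟨ shrink ⟩
      d ^ n * M           ∎))
      where n = suc d * e
    ... | T , [] , |T| , _ , cov = T , |T| , λ u u<M → case cov u u<M of λ where
      (inj₁ ())
      (inj₂ hit) → hit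

-- From |kA| to an interval

combine : ℤ → List ℤ → List ℤ → List ℤ
combine c = cartesianProductWith (λ a b → a ℤ.+ c ℤ.* b)

∈-combine⁺ : ∀ c {xs ys x y} → x ∈ xs → y ∈ ys → x ℤ.+ c ℤ.* y ∈ combine c xs ys
∈-combine⁺ c = ∈-cartesianProductWith⁺ _

∈-combine⁻ : ∀ c xs ys {z} → z ∈ combine c xs ys → ∃₂ λ x y → x ∈ xs × y ∈ ys × z ≡ x ℤ.+ c ℤ.* y
∈-combine⁻ c = ∈-cartesianProductWith⁻ _

·-combine : ∀ c {A B} k {x y} → x ∈ k · A → y ∈ k · B → x ℤ.+ c ℤ.* y ∈ k · combine c A B
·-combine c zero (here refl) (here refl) = here (zero-combine c)
  where
  zero-combine : ∀ c → + 0 ℤ.+ c ℤ.* + 0 ≡ + 0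
  zero-combine = ℤSolver.solve-∀
·-combine c {A} {B} (suc k) x∈ y∈ with ∈-⊕⁻ A (k · A) x∈ | ∈-⊕⁻ B (k · B) y∈
... | a , x , a∈ , x∈′ , refl | b , y , b∈ , y∈′ , refl =
  subst (_∈ suc k · combine c A B) (interchange c a x b y) (∈-⊕⁺ (∈-combine⁺ c a∈ b∈) (·-combine c k x∈′ y∈′))
  where
  interchange : ∀ c a x b y → (a ℤ.+ c ℤ.* b) ℤ.+ (x ℤ.+ c ℤ.* y) ≡ (a ℤ.+ x) ℤ.+ c ℤ.* (b ℤ.+ y)
  interchange = ℤSolver.solve-∀

zero∈· : ∀ k → + 0 ∈ k · (+ 0 ∷ [])
zero∈· zero = here refl
zero∈· (suc k) = ∈-⊕⁺ {+ 0 ∷ []} {k · (+ 0 ∷ [])} (here refl) (zero∈· k)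

combine-⊖ : ∀ c {A B Δ D} → A ⊖ A ⊆ Δ → B ⊖ B ⊆ D → combine c A B ⊖ combine c A B ⊆ combine c Δ D
combine-⊖ c {A} {B} {Δ} {D} A⊖A⊆ B⊖B⊆ z∈ with ∈-⊖⁻ (combine c A B) (combine c A B) z∈
... | _ , _ , p , q , refl with ∈-combine⁻ c A B p | ∈-combine⁻ c A B q
...   | a , b , a∈ , b∈ , refl | a′ , b′ , a′∈ , b′∈ , refl =
  subst (_∈ combine c Δ D) (interchange c a b a′ b′) (∈-combine⁺ c (A⊖A⊆ (∈-⊖⁺ a∈ a′∈)) (B⊖B⊆ (∈-⊖⁺ b∈ b′∈)))
  where
  interchange : ∀ c a b a′ b′ → (a ℤ.- a′) ℤ.+ c ℤ.* (b ℤ.- b′) ≡ (a ℤ.+ c ℤ.* b) ℤ.- (a′ ℤ.+ c ℤ.* b′)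
  interchange = ℤSolver.solve-∀

commonMultiple : ∀ (xs : List ℕ) → ∃ λ E → NonZero E × (∀ {x} → x ∈ xs → x ≢ 0 → x ℕ∣.∣ E)
commonMultiple [] = 1 , _ , λ ()
commonMultiple (zero ∷ xs) with commonMultiple xs
... | E , E≢0 , mult = E , E≢0 , λ where
  (here refl) x≢0 → ⊥-elim (x≢0 refl)
  (there x∈) x≢0 → mult x∈ x≢0
commonMultiple (suc x ∷ xs) with commonMultiple xs
... | E , E≢0 , mult = suc x * E , m*n≢0 (suc x) E {{_}} {{E≢0}} , λ where
  (here refl) _ → ℕ∣.m∣m*n E
  (there x∈) x≢0 → ℕ∣.∣n⇒∣m*n (suc x) (mult x∈ x≢0)

n<2^n : ∀ n → n < 2 ^ n
n<2^n zero = s≤s z≤n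
n<2^n (suc n) = begin-strict
  suc n               ≤⟨ n<2^n n ⟩
  2 ^ n               <⟨ m<m+n (2 ^ n) (≤-trans (m^n>0 2 n) (m≤m+n (2 ^ n) 0)) ⟩
  2 ^ n + (2 ^ n + 0) ∎
  where open ≤-Reasoning

-- Lifting a covering of ℤ/M to an interval of integers

module Lift (M : ℕ) {{_ : NonZero M}} (k : ℕ) (A : List ℤ) (T : List ℕ) where
  open Modular M

  -- The shift 0 is adjoined because only one summand of a k-fold sum carries a translate from T;
  -- the others are reductions of elements of A itself.
  residues : List ℕ
  residues = cartesianProductWith (λ a t → residue (a ℤ.+ + t)) A (0 ∷ T)

  place : ℕ → ℕ → ℤ
  place r j = + r ℤ.+ + j ℤ.* + M

  lifted : List ℤ
  lifted = cartesianProductWith place residues (upTo (suc (suc k)))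

  residue∈ : ∀ {a t} → a ∈ A → t ∈ 0 ∷ T → residue (a ℤ.+ + t) ∈ residues
  residue∈ = ∈-cartesianProductWith⁺ _

  place∈ : ∀ {r j} → r ∈ residues → j ≤ suc k → place r j ∈ lifted
  place∈ r∈ j≤ = ∈-cartesianProductWith⁺ place r∈ (∈-upTo⁺ (s≤s j≤))

  liftSum : ∀ j {x} → x ∈ j · A → ∃ λ z → + z ∈ j · lifted × + z ≈ x × z ≤ j * M
  liftSum zero (here refl) = 0 , here refl , ≈-refl , z≤n
  liftSum (suc j) x∈ with ∈-⊕⁻ A (j · A) x∈
  ... | a , x , a∈ , x∈′ , refl with liftSum j x∈′
  ...   | z , z∈ , z≈x , z≤ = r + z ,
    subst (_∈ suc j · lifted) eq (∈-⊕⁺ (place∈ (residue∈ a∈ (here refl)) z≤n) z∈) ,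
    ≈-+ (subst (+ r ≈_) (ℤ.+-identityʳ a) (residue≈ (a ℤ.+ + 0))) z≈x ,
    +-mono-≤ (<⇒≤ (residue< (a ℤ.+ + 0))) z≤
    where
    r = residue (a ℤ.+ + 0)
    drop : ∀ r z m → (r ℤ.+ + 0 ℤ.* m) ℤ.+ z ≡ r ℤ.+ z
    drop = ℤSolver.solve-∀
    eq : place r 0 ℤ.+ + z ≡ + (r + z)
    eq = drop (+ r) (+ z) (+ M)

  ≈⇒quotient : ∀ {w y} → w ≤ y → + y ≈ + w → ∃ λ q → y ≡ w + q * M
  ≈⇒quotient {w} {y} w≤y (congruent d) with subst (M ℕ∣.∣_) abs (ℤ∣.∣⇒∣ᵤ d)
    where
    abs : ℤ.∣ + y ℤ.- + w ∣ ≡ y ∸ w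
    abs = cong ℤ.∣_∣ (trans (ℤ.[+m]-[+n]≡m⊖n y w) (ℤ.⊖-≥ w≤y))
  ... | ℕ∣.divides q eq = q , trans (sym (m+[n∸m]≡n w≤y)) (cong (λ z → w + z) eq)

  -- A difference of two residues lies strictly between -M and M, where each class has at most these
  -- two candidates. This controls the failure of reduction modulo M to respect subtraction.
  wrap : ∀ {r r′ z} → r < M → r′ < M → + r ℤ.- + r′ ≈ z →
    + r ℤ.- + r′ ≡ + residue z ⊎ + r ℤ.- + r′ ≡ + residue z ℤ.- + M
  wrap {r} {r′} {z} r< r′< c with r′ ≤? r
  ... | yes r′≤r = inj₁ (trans eq (cong (λ n → + n) (≈⇒≡ (≤-<-trans (m∸n≤m r r′) r<) (residue< z)
      (≈-trans (subst (_≈ z) eq c) (≈-sym (residue≈ z))))))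
    where
    eq : + r ℤ.- + r′ ≡ + (r ∸ r′)
    eq = trans (ℤ.[+m]-[+n]≡m⊖n r r′) (ℤ.⊖-≥ r′≤r)
  ... | no r′≰r = inj₂ (trans eq (cong (λ n → + n ℤ.- + M) (≈⇒≡ below (residue< z) (≈-trans up (≈-sym (residue≈ z))))))
    where
    n = r + (M ∸ r′)
    below : n < M
    below = <-≤-trans (+-monoˡ-< (M ∸ r′) (≰⇒> r′≰r)) (≤-reflexive (m+[n∸m]≡n (<⇒≤ r′<)))
    shiftM : ∀ r m r′ → r ℤ.- r′ ≡ (r ℤ.+ (m ℤ.- r′)) ℤ.- m
    shiftM = ℤSolver.solve-∀
    eq : + r ℤ.- + r′ ≡ + n ℤ.- + M
    eq = trans (shiftM (+ r) (+ M) (+ r′)) (cong (λ w → + r ℤ.+ w ℤ.- + M) (trans (ℤ.[+m]-[+n]≡m⊖n M r′) (ℤ.⊖-≥ (<⇒≤ r′<))))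
    back : ∀ n m → n ≡ (n ℤ.- m) ℤ.+ + 1 ℤ.* m
    back = ℤSolver.solve-∀
    up : + n ≈ z
    up = ≈-trans (≈-by (+ 1) (trans (back (+ n) (+ M)) (cong (λ w → w ℤ.+ + 1 ℤ.* + M) (sym eq)))) c

  naturals : List ℕ → List ℤ
  naturals = map (λ n → + n)

  module Differences (Δ : List ℤ) (A⊖A⊆Δ : A ⊖ A ⊆ Δ) where

    -- Residues indexed by a difference of A and a difference of shifts, so that their number grows
    -- with |Δ| and not with |A|².
    ρs : List ℕ
    ρs = cartesianProductWith (λ δ τ → residue (δ ℤ.+ τ)) Δ (naturals (0 ∷ T) ⊖ naturals (0 ∷ T))

    -- The second range is longer by one: when `wrap` borrows M, the coefficient j - j′ becomes j -
    -- (1 + j′).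
    multiples : List ℤ
    multiples = naturals (upTo (suc (suc k))) ⊖ naturals (upTo (suc (suc (suc k))))

    differences : List ℤ
    differences = cartesianProductWith (λ r i → + r ℤ.+ i ℤ.* + M) ρs multiples

    lifted-⊖ : lifted ⊖ lifted ⊆ differences
    lifted-⊖ z∈ with ∈-⊖⁻ lifted lifted z∈
    ... | _ , _ , p , q , refl
      with ∈-cartesianProductWith⁻ place residues (upTo (suc (suc k))) p | ∈-cartesianProductWith⁻ place residues (upTo (suc (suc k))) q
    ... | _ , j , r∈ , j∈ , refl | _ , j′ , r′∈ , j′∈ , refl
      with ∈-cartesianProductWith⁻ _ A (0 ∷ T) r∈ | ∈-cartesianProductWith⁻ _ A (0 ∷ T) r′∈
    ... | a , t , a∈ , t∈ , refl | a′ , t′ , a′∈ , t′∈ , refl = go (wrap (residue< x) (residue< x′) sameClass)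
      where
      x = a ℤ.+ + t
      x′ = a′ ℤ.+ + t′
      z = (a ℤ.- a′) ℤ.+ (+ t ℤ.- + t′)
      regroup : ∀ a t a′ t′ → (a ℤ.+ t) ℤ.- (a′ ℤ.+ t′) ≡ (a ℤ.- a′) ℤ.+ (t ℤ.- t′)
      regroup = ℤSolver.solve-∀
      sameClass : + residue x ℤ.- + residue x′ ≈ z
      sameClass = subst (+ residue x ℤ.- + residue x′ ≈_) (regroup a (+ t) a′ (+ t′)) (≈-+ (residue≈ x) (≈-neg (residue≈ x′)))
      ρ∈ : residue z ∈ ρs
      ρ∈ = ∈-cartesianProductWith⁺ _ (A⊖A⊆Δ (∈-⊖⁺ a∈ a′∈)) (∈-⊖⁺ (∈-map⁺ (λ n → + n) t∈) (∈-map⁺ (λ n → + n) t′∈))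
      multiple : ∀ {i} → i < suc (suc (suc k)) → + j ℤ.- + i ∈ multiples
      multiple i< = ∈-⊖⁺ (∈-map⁺ (λ n → + n) j∈) (∈-map⁺ (λ n → + n) (∈-upTo⁺ i<))
      j′< = ∈-upTo⁻ j′∈
      split : ∀ r r′ j j′ m → (r ℤ.+ j ℤ.* m) ℤ.- (r′ ℤ.+ j′ ℤ.* m) ≡ (r ℤ.- r′) ℤ.+ (j ℤ.- j′) ℤ.* m
      split = ℤSolver.solve-∀
      borrow : ∀ r j j′ m → (r ℤ.- m) ℤ.+ (j ℤ.- j′) ℤ.* m ≡ r ℤ.+ (j ℤ.- (+ 1 ℤ.+ j′)) ℤ.* m
      borrow = ℤSolver.solve-∀
      go : + residue x ℤ.- + residue x′ ≡ + residue z ⊎ + residue x ℤ.- + residue x′ ≡ + residue z ℤ.- + M →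
        place (residue x) j ℤ.- place (residue x′) j′ ∈ differences
      go (inj₁ e) = subst (_∈ differences)
        (sym (trans (split (+ residue x) (+ residue x′) (+ j) (+ j′) (+ M)) (cong (λ w → w ℤ.+ (+ j ℤ.- + j′) ℤ.* + M) e)))
        (∈-cartesianProductWith⁺ _ ρ∈ (multiple (m<n⇒m<1+n j′<)))
      go (inj₂ e) = subst (_∈ differences)
        (sym (trans (split (+ residue x) (+ residue x′) (+ j) (+ j′) (+ M))
          (trans (cong (λ w → w ℤ.+ (+ j ℤ.- + j′) ℤ.* + M) e) (borrow (+ residue z) (+ j) (+ j′) (+ M)))))
        (∈-cartesianProductWith⁺ _ ρ∈ (multiple (s≤s j′<)))

    card-lifted-⊖ : card (lifted ⊖ lifted) ≤
      length Δ * (suc (length T) * suc (length T)) * (suc (suc k) * suc (suc (suc k)))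
    card-lifted-⊖ = ≤-trans (card≤length differences lifted-⊖) (≤-reflexive (begin
      length differences ≡⟨ length-cartesianProductWith (λ r i → + r ℤ.+ i ℤ.* + M) ρs multiples ⟩
      length ρs * length multiples
        ≡⟨ cong₂ _*_ (length-cartesianProductWith (λ δ τ → residue (δ ℤ.+ τ)) Δ (naturals (0 ∷ T) ⊖ naturals (0 ∷ T)))
             (length-naturals-⊖ (upTo (suc (suc k))) (upTo (suc (suc (suc k))))) ⟩
      length Δ * length (naturals (0 ∷ T) ⊖ naturals (0 ∷ T)) * (length (upTo (suc (suc k))) * length (upTo (suc (suc (suc k)))))
        ≡⟨ cong₂ _*_ (cong (length Δ *_) (length-naturals-⊖ (0 ∷ T) (0 ∷ T)))
             (cong₂ _*_ (length-upTo (suc (suc k))) (length-upTo (suc (suc (suc k))))) ⟩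
      length Δ * (suc (length T) * suc (length T)) * (suc (suc k) * suc (suc (suc k))) ∎))
      where
      open ≡-Reasoning
      length-naturals-⊖ : ∀ xs ys → length (naturals xs ⊖ naturals ys) ≡ length xs * length ys
      length-naturals-⊖ xs ys = trans (length-cartesianProductWith ℤ._-_ (naturals xs) (naturals ys))
        (cong₂ _*_ (length-map (λ n → + n) xs) (length-map (λ n → + n) ys))

-- For y in the interval, the covering supplies a sum r + z of lifted elements congruent to y, and
-- one summand absorbs the missing q M. The interval starts after `suc k * M` because r + z can be
-- that large, which keeps q non-negative; its end `suc (suc k) * M` bounds q by `suc (suc k)`, the
-- largest multiple that `lifted` provides.
lifted-covers : ∀ (M : ℕ) {{_ : NonZero M}} k A T → (let open Modular M) →
  (∀ u → u < M → ∃₂ λ x t → x ∈ suc k · A × t ∈ T × + u ≈ x ℤ.+ + t) →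
  CoversInterval (suc k) (Lift.lifted M (suc k) A T) M
lifted-covers M k A T reach = + (suc k * M) , λ i _ i≤M → ∈⇒InSumset (suc k) (hit (suc k * M + i) (m≤m+n (suc k * M) i)
    (≤-trans (+-monoʳ-≤ (suc k * M) i≤M) (≤-reflexive (+-comm (suc k * M) M))))
  where
  open Modular M
  open Lift M (suc k) A T
  swap : ∀ a x t → (a ℤ.+ x) ℤ.+ t ≡ (a ℤ.+ t) ℤ.+ x
  swap = ℤSolver.solve-∀

  assemble : ∀ {a t z q} → a ∈ A → t ∈ T → + z ∈ k · lifted → q ≤ suc (suc k) →
    + (residue (a ℤ.+ + t) + z + q * M) ∈ suc k · lifted
  assemble {a} {t} {z} {q} a∈ t∈ z∈ q≤ = subst (_∈ suc k · lifted)
    (trans (swap (+ r) (+ q ℤ.* + M) (+ z)) (cong (λ v → + (r + z) ℤ.+ v) (sym (ℤ.pos-* q M))))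
    (∈-⊕⁺ (place∈ (residue∈ a∈ (there t∈)) q≤) z∈)
    where r = residue (a ℤ.+ + t)

  hit : ∀ y → suc k * M ≤ y → y ≤ suc (suc k) * M → + y ∈ suc k · lifted
  hit y lo hi with reach (residue (+ y)) (residue< (+ y))
  ... | x , t , x∈ , t∈ , u≈ with ∈-⊕⁻ A (k · A) x∈
  ...   | a , x′ , a∈ , x′∈ , refl with liftSum k x′∈
  ...     | z , z∈ , z≈x′ , z≤ = finish (≈⇒quotient w≤y y≈w)
    where
    r = residue (a ℤ.+ + t)
    w≤y : r + z ≤ y
    w≤y = ≤-trans (+-mono-≤ (<⇒≤ (residue< (a ℤ.+ + t))) z≤) lo
    y≈w : + y ≈ + (r + z)
    y≈w = ≈-trans (≈-sym (residue≈ (+ y))) (≈-trans u≈ (subst (_≈ + (r + z)) (sym (swap a x′ (+ t)))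
      (≈-sym (≈-+ (residue≈ (a ℤ.+ + t)) z≈x′))))
    finish : (∃ λ q → y ≡ r + z + q * M) → + y ∈ suc k · lifted
    finish (q , y≡) = subst (λ n → + n ∈ suc k · lifted) (sym y≡)
      (assemble a∈ t∈ z∈ (*-cancelʳ-≤ q (suc (suc k)) M (≤-trans (m≤n+m (q * M) (r + z)) (subst (_≤ suc (suc k) * M) y≡ hi))))

-- Sums of dilates of A and the choice of M

module Stages (k : ℕ) (A : List ℤ) (M : ℕ) {{_ : NonZero M}} (L≥2 : 2 ≤ card (k · A))
  (separated : Modular.Separated M (nub (k · A))) where
  open ≤-Reasoning
  open Modular M

  S = nub (k · A)
  L = card (k · A)
  N = card (A ⊖ A)

  -- In reps≥, the j-th dilate loses at most (L^j)²/M elements to collisions; since L ≥ 2 the losses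
  -- add up to at most 2 (L^j)²/M.
  record Stage (j : ℕ) : Set where
    field
      base reps diffs : List ℤ
      reps⊆ : reps ⊆ k · base
      incongruent : Incongruent reps
      reps≤ : length reps ≤ L ^ j
      reps≥ : M * L ^ j ≤ M * length reps + 2 * (L ^ j * L ^ j)
      base-⊖ : base ⊖ base ⊆ diffs
      |diffs| : length diffs ≡ N ^ j

  -- The old loss 2 l² is multiplied by L, and 2 L l² ≤ (L l)² because L ≥ 2. The new collisions
  -- cost at most another (L l)², since n ≤ l.
  extend-≥ : ∀ {l n y} → n ≤ l → M * l ≤ M * n + 2 * (l * l) → M * (n * L) ≤ M * y + (n * L) * (n * L) →
    M * (L * l) ≤ M * y + 2 * (L * l * (L * l))
  extend-≥ {l} {n} {y} n≤l reps≥ many = begin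
    M * (L * l)                         ≡⟨ e₁ M L l ⟩
    L * (M * l)                         ≤⟨ *-monoʳ-≤ L reps≥ ⟩
    L * (M * n + 2 * (l * l))           ≡⟨ e₂ L M n (l * l) ⟩
    M * (n * L) + L * 2 * (l * l)       ≤⟨ +-mono-≤ many (*-monoˡ-≤ (l * l) (*-monoʳ-≤ L L≥2)) ⟩
    M * y + (n * L) * (n * L) + L * L * (l * l)
      ≤⟨ +-monoˡ-≤ (L * L * (l * l)) (+-monoʳ-≤ (M * y) (*-mono-≤ (*-monoˡ-≤ L n≤l) (*-monoˡ-≤ L n≤l))) ⟩
    M * y + (l * L) * (l * L) + L * L * (l * l) ≡⟨ e₃ (M * y) l L ⟩
    M * y + 2 * (L * l * (L * l)) ∎
    where
    e₁ : ∀ a b c → a * (b * c) ≡ b * (a * c)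
    e₁ = solve-∀
    e₂ : ∀ L M n z → L * (M * n + 2 * z) ≡ M * (n * L) + L * 2 * z
    e₂ = solve-∀
    e₃ : ∀ a l L → a + (l * L) * (l * L) + L * L * (l * l) ≡ a + 2 * (L * l * (L * l))
    e₃ = solve-∀

  stage : ∀ j → Stage j
  stage zero = record
    { base = + 0 ∷ [] ; reps = + 0 ∷ [] ; diffs = + 0 ∷ []
    ; reps⊆ = λ { (here refl) → zero∈· k }
    ; incongruent = [] ∷ []
    ; reps≤ = ≤-refl
    ; reps≥ = m≤m+n _ _
    ; base-⊖ = id
    ; |diffs| = refl
    }
  stage (suc j) = extend (spread reps S incongruent (nub-unique (k · A)) separated)
    where
    open Stage (stage j)
    extend : (∃₂ λ (c : ℤ) Y → (∀ {y} → y ∈ Y → ∃₂ λ x s → x ∈ reps × s ∈ S × y ≡ x ℤ.+ c ℤ.* s) × Incongruent Y ×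
      M * (length reps * L) ≤ M * length Y + (length reps * L) * (length reps * L)) → Stage (suc j)
    extend (c , Y , Y⊆ , incY , many) = record
      { base = combine c base A ; reps = Y ; diffs = combine c diffs (nub (A ⊖ A))
      ; reps⊆ = λ y∈ → case Y⊆ y∈ of λ where
          (x , s , x∈ , s∈ , refl) → ·-combine c {base} {A} k (reps⊆ x∈) (∈-nub⁻ (k · A) s∈)
      ; incongruent = incY
      ; reps≤ = begin
          length Y                            ≤⟨ unique-⊆⇒length≤ (Incongruent⇒Unique incY) (λ y∈ → case Y⊆ y∈ of λ where
                                                   (x , s , x∈ , s∈ , refl) → ∈-combine⁺ c x∈ s∈) ⟩
          length (combine c reps S)           ≡⟨ length-cartesianProductWith (λ x s → x ℤ.+ c ℤ.* s) reps S ⟩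
          length reps * L                     ≤⟨ *-monoˡ-≤ L reps≤ ⟩
          L ^ j * L                           ≡⟨ *-comm (L ^ j) L ⟩
          L * L ^ j                           ∎
      ; reps≥ = extend-≥ reps≤ reps≥ many
      ; base-⊖ = combine-⊖ c {base} {A} {diffs} {nub (A ⊖ A)} base-⊖ (∈-nub⁺ {A ⊖ A})
      ; |diffs| = trans (length-cartesianProductWith (λ x s → x ℤ.+ c ℤ.* s) diffs (nub (A ⊖ A)))
          (trans (cong (_* N) |diffs|) (*-comm (N ^ j) N))
      }

  -- The total loss is at most 2 l² / M, and this is at most l / 2 once 4 l ≤ M.
  half : ∀ {l n} → 4 * l ≤ M → M * l ≤ M * n + 2 * (l * l) → l ≤ 2 * n
  half {l} {n} 4l≤M reps≥ = *-cancelˡ-≤ M (+-cancelʳ-≤ (M * l) (M * l) (M * (2 * n)) (begin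
    M * l + M * l                              ≤⟨ +-mono-≤ reps≥ reps≥ ⟩
    M * n + 2 * (l * l) + (M * n + 2 * (l * l)) ≡⟨ e₁ M n l ⟩
    M * (2 * n) + 4 * l * l                    ≤⟨ +-monoʳ-≤ (M * (2 * n)) (*-monoˡ-≤ l 4l≤M) ⟩
    M * (2 * n) + M * l                        ∎))
    where
    e₁ : ∀ M n l → M * n + 2 * (l * l) + (M * n + 2 * (l * l)) ≡ M * (2 * n) + 4 * l * l
    e₁ = solve-∀

-- M = F E + 1 is coprime to E and so to every difference, since these divide E.
separated-modulo : ∀ {S : List ℤ} {E} F M → (∀ {s s′} → s ∈ S → s′ ∈ S → s ≢ s′ → ℤ.∣ s ℤ.- s′ ∣ ℕ∣.∣ E) →
  M ≡ F * E + 1 → .{{_ : NonZero M}} → ∀ {s s′} → s ∈ S → s′ ∈ S → s ≢ s′ → ∀ z →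
  + M ℤ∣.∣ z ℤ.* (s ℤ.- s′) → + M ℤ∣.∣ z
separated-modulo {E = E} F M multiple refl {s} {s′} s∈ s′∈ s≢s′ z d = ℤ∣.∣ᵤ⇒∣ (coprime-divisor coprime
  (subst (M ℕ∣.∣_) (trans (ℤ.abs-* z (s ℤ.- s′)) (*-comm ℤ.∣ z ∣ g)) (ℤ∣.∣⇒∣ᵤ d)))
  where
  g = ℤ.∣ s ℤ.- s′ ∣
  coprime : Coprime M g
  coprime {c} (c∣M , c∣g) = ℕ∣.∣1⇒≡1 (ℕ∣.∣m+n∣m⇒∣n c∣M (ℕ∣.∣n⇒∣m*n F (ℕ∣.∣-trans c∣g (multiple s∈ s′∈ s≢s′))))

differencesMultiple : ∀ (S : List ℤ) → ∃ λ E → NonZero E ×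
  (∀ {s s′} → s ∈ S → s′ ∈ S → s ≢ s′ → ℤ.∣ s ℤ.- s′ ∣ ℕ∣.∣ E)
differencesMultiple S with commonMultiple (map ℤ.∣_∣ (S ⊖ S))
... | E , E≢0 , multiple = E , E≢0 , λ {s} {s′} s∈ s′∈ s≢s′ → multiple (∈-map⁺ ℤ.∣_∣ (∈-⊖⁺ s∈ s′∈))
  (λ e → s≢s′ (ℤ.i-j≡0⇒i≡j s s′ (ℤ.∣i∣≡0⇒i≡0 e)))

module Amplification (k : ℕ) (A : List ℤ) (L≥2 : 2 ≤ card (k · A)) (E : ℕ) {{_ : NonZero E}}
  (multiple : ∀ {s s′} → s ∈ nub (k · A) → s′ ∈ nub (k · A) → s ≢ s′ → ℤ.∣ s ℤ.- s′ ∣ ℕ∣.∣ E) where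
  open ≤-Reasoning

  L = card (k · A)
  N = card (A ⊖ A)

  -- Independent of m: with `suc (8 * E) * e` translates and `e` linear in m, the set of shifts
  -- together with 0 has at most `slope * m` elements.
  slope : ℕ
  slope = 1 + (1 + 8 * E) * (1 + 4 * E + L)

  instance
    L≢0 : NonZero L
    L≢0 = >-nonZero (<⇒≤ L≥2)

  -- The factor E with the added 1 makes M coprime to all differences, the factor 4 keeps at least
  -- half of the L^m sums, and since E does not depend on m these sums have density at least 1/(8E +
  -- 1) in ℤ/M.
  module _ (m : ℕ) (1≤m : 1 ≤ m) (M : ℕ) (M≡ : M ≡ 4 * L ^ m * E + 1) where

    4l≤M : 4 * L ^ m ≤ M
    4l≤M = begin
      4 * L ^ m         ≤⟨ m≤m*n (4 * L ^ m) E ⟩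
      4 * L ^ m * E     ≤⟨ m≤m+n _ 1 ⟩
      4 * L ^ m * E + 1 ≡⟨ M≡ ⟨
      M                 ∎

    l≤M : L ^ m ≤ M
    l≤M = ≤-trans (m≤n*m (L ^ m) 4) 4l≤M

    2≤M : 2 ≤ M
    2≤M = ≤-trans (s≤s (s≤s z≤n)) (≤-trans (*-monoʳ-≤ 4 (m^n>0 L m)) 4l≤M)

    instance
      M≢0 : NonZero M
      M≢0 = >-nonZero (<⇒≤ 2≤M)

    open Stages k A M L≥2 (separated-modulo (4 * L ^ m) M multiple M≡) using (Stage; stage; half)
    open Stage (stage m)

    dense : M ≤ suc (8 * E) * length reps
    dense = go (length reps) (half 4l≤M reps≥)
      where
      e₁ : ∀ E n → 4 * (2 * n) * E ≡ 8 * E * n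
      e₁ = solve-∀
      go : ∀ n → L ^ m ≤ 2 * n → M ≤ suc (8 * E) * n
      go zero l≤ = ⊥-elim (<⇒≱ (m^n>0 L m) l≤)
      go n@(suc _) l≤ = begin
        M                      ≡⟨ M≡ ⟩
        4 * L ^ m * E + 1      ≤⟨ +-monoˡ-≤ 1 (*-monoˡ-≤ E (*-monoʳ-≤ 4 l≤)) ⟩
        4 * (2 * n) * E + 1    ≡⟨ cong (_+ 1) (e₁ E n) ⟩
        8 * E * n + 1          ≤⟨ +-monoʳ-≤ (8 * E * n) (s≤s z≤n) ⟩
        8 * E * n + n          ≡⟨ +-comm (8 * E * n) n ⟩
        suc (8 * E) * n        ∎

    -- A crude upper bound for the binary logarithm of M, from M ≤ (1 + 4E) L^m and n < 2^n; only
    -- its linearity in m matters.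
    e : ℕ
    e = 1 + 4 * E + L * m

    M<2^e : M < 2 ^ e
    M<2^e = begin-strict
      M                               ≡⟨ M≡ ⟩
      4 * L ^ m * E + 1               ≤⟨ +-monoʳ-≤ (4 * L ^ m * E) (m^n>0 L m) ⟩
      4 * L ^ m * E + L ^ m           ≡⟨ e₁ (L ^ m) E ⟩
      (1 + 4 * E) * L ^ m             <⟨ *-monoˡ-< (L ^ m) {{m^n≢0 L m}} (n<2^n (1 + 4 * E)) ⟩
      2 ^ (1 + 4 * E) * L ^ m         ≤⟨ *-monoʳ-≤ (2 ^ (1 + 4 * E)) (^-monoˡ-≤ m (<⇒≤ (n<2^n L))) ⟩
      2 ^ (1 + 4 * E) * (2 ^ L) ^ m   ≡⟨ cong (2 ^ (1 + 4 * E) *_) (^-*-assoc 2 L m) ⟩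
      2 ^ (1 + 4 * E) * 2 ^ (L * m)   ≡⟨ ^-distribˡ-+-* 2 (1 + 4 * E) (L * m) ⟨
      2 ^ e                           ∎
      where
      e₁ : ∀ l E → 4 * l * E + l ≡ (1 + 4 * E) * l
      e₁ = solve-∀

    translates≤ : ∀ c → 1 + suc c * e ≤ (1 + suc c * (1 + 4 * E + L)) * m
    translates≤ c = begin
      1 + suc c * (1 + 4 * E + L * m)           ≤⟨ +-mono-≤ 1≤m (*-monoʳ-≤ (suc c) (+-monoˡ-≤ (L * m) (m≤m*n (1 + 4 * E) m {{>-nonZero 1≤m}}))) ⟩
      m + suc c * ((1 + 4 * E) * m + L * m)     ≡⟨ cong (λ z → m + suc c * z) (*-distribʳ-+ m (1 + 4 * E) L) ⟨
      m + suc c * ((1 + 4 * E + L) * m)         ≡⟨ cong (λ z → m + z) (*-assoc (suc c) (1 + 4 * E + L) m) ⟨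
      (1 + suc c * (1 + 4 * E + L)) * m         ∎

    amplify : 1 ≤ k → ∃ λ n → Achievable k M n ×
      n ≤ N ^ m * ((slope * m) * (slope * m)) * (suc (suc k) * suc (suc (suc k)))
    amplify (s≤s {n = k′} _) = lift (Modular.Cover.cover M reps incongruent (8 * E) dense {{m*n≢0 8 E}} e M<2^e)
      where
      open Modular M using (_≈_)
      K = suc (suc k) * suc (suc (suc k))
      lift : (∃ λ (T : List ℕ) → length T ≡ suc (8 * E) * e ×
        (∀ u → u < M → ∃ λ t → t ∈ T × ∃ λ x → x ∈ reps × + u ≈ x ℤ.+ + t)) →
        ∃ λ n → Achievable k M n × n ≤ N ^ m * ((slope * m) * (slope * m)) * K
      lift (T , |T| , reach) = card (lifted ⊖ lifted) , (lifted , lifted-covers M k′ base T reach′ , diffCard lifted) , (begin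
        card (lifted ⊖ lifted)                                          ≤⟨ card-lifted-⊖ ⟩
        length diffs * (suc (length T) * suc (length T)) * K            ≤⟨ *-monoˡ-≤ K (*-mono-≤ (≤-reflexive |diffs|) (*-mono-≤ |T|≤ |T|≤)) ⟩
        N ^ m * ((slope * m) * (slope * m)) * K                         ∎)
        where
        open Lift M k base T using (lifted; module Differences)
        open Differences diffs base-⊖
        |T|≤ : suc (length T) ≤ slope * m
        |T|≤ = ≤-trans (≤-reflexive (cong suc |T|)) (translates≤ (8 * E))
        reach′ : ∀ u → u < M → ∃₂ λ x t → x ∈ k · base × t ∈ T × + u ≈ x ℤ.+ + t
        reach′ u u< = case reach u u< of λ where (t , t∈ , x , x∈ , p) → x , t , reps⊆ x∈ , t∈ , p

-- The bound on β_k is applied to the interval of length M ≥ L^m produced by `amplify`. The result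
-- is (L^s)^m ≤ C m^(2t) (N^t)^m, the factor m^(2t) coming from the square of the number of shifts;
-- growth in m removes C and the polynomial.
beta-sumset : ∀ k s t → 1 ≤ k → BetaAtLeast k s t → ∀ A → 0 < card A → card (k · A) ^ s ≤ card (A ⊖ A) ^ t
beta-sumset k s t 1≤k β A A≢∅ with 2 ≤? card (k · A)
... | no L≱2 = begin
  card (k · A) ^ s   ≤⟨ ^-monoˡ-≤ s (s≤s⁻¹ (≰⇒> L≱2)) ⟩
  1 ^ s              ≡⟨ ^-zeroˡ s ⟩
  1                  ≤⟨ m^n>0 N {{>-nonZero N>0}} t ⟩
  N ^ t              ∎
  where
  open ≤-Reasoning
  N = card (A ⊖ A)
  N>0 : 0 < N
  N>0 = let a , a∈ = card>0⇒∈ {A} A≢∅ in card>0 (∈-⊖⁺ {A} {A} a∈ a∈)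
... | yes L≥2 with differencesMultiple (nub (k · A))
...   | E , E≢0 , multiple = exponential-beats-polynomial (L ^ s) (N ^ t) ((slope * slope * K) ^ t) (2 * t) bound
  where
  open ≤-Reasoning
  open Amplification k A L≥2 E {{E≢0}} multiple
  K = suc (suc k) * suc (suc (suc k))
  rearrange : ∀ x σ m K → x * ((σ * m) * (σ * m)) * K ≡ σ * σ * K * (m * (m * 1)) * x
  rearrange = solve-∀
  expand : ∀ m σ K → (N ^ m * ((σ * m) * (σ * m)) * K) ^ t ≡ (σ * σ * K) ^ t * m ^ (2 * t) * (N ^ t) ^ m
  expand m σ K = begin-equality
    (N ^ m * ((σ * m) * (σ * m)) * K) ^ t       ≡⟨ cong (_^ t) (rearrange (N ^ m) σ m K) ⟩
    (σ * σ * K * m ^ 2 * N ^ m) ^ t             ≡⟨ ^-distribʳ-* (σ * σ * K * m ^ 2) (N ^ m) t ⟩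
    (σ * σ * K * m ^ 2) ^ t * (N ^ m) ^ t       ≡⟨ cong (_* (N ^ m) ^ t) (^-distribʳ-* (σ * σ * K) (m ^ 2) t) ⟩
    (σ * σ * K) ^ t * (m ^ 2) ^ t * (N ^ m) ^ t ≡⟨ cong₂ (λ x y → (σ * σ * K) ^ t * x * y) (^-*-assoc m 2 t) (^-swap N m t) ⟩
    (σ * σ * K) ^ t * m ^ (2 * t) * (N ^ t) ^ m ∎
  bound : ∀ m → 1 ≤ m → (L ^ s) ^ m ≤ (slope * slope * K) ^ t * m ^ (2 * t) * (N ^ t) ^ m
  bound m 1≤m = conclude (4 * L ^ m * E + 1) refl
    where
    conclude : ∀ M → M ≡ 4 * L ^ m * E + 1 → (L ^ s) ^ m ≤ (slope * slope * K) ^ t * m ^ (2 * t) * (N ^ t) ^ m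
    conclude M M≡ with amplify m 1≤m M M≡ 1≤k
    ... | n , ach , n≤ = begin
      (L ^ s) ^ m                                         ≡⟨ ^-swap L s m ⟩
      (L ^ m) ^ s                                         ≤⟨ ^-monoˡ-≤ s (l≤M m 1≤m M M≡) ⟩
      M ^ s                                               ≤⟨ β M (2≤M m 1≤m M M≡) n ach ⟩
      n ^ t                                               ≤⟨ ^-monoˡ-≤ t n≤ ⟩
      (N ^ m * ((slope * m) * (slope * m)) * K) ^ t       ≡⟨ expand m slope K ⟩
      (slope * slope * K) ^ t * m ^ (2 * t) * (N ^ t) ^ m ∎

-- Products of coverings and the monotonicity of kβ_k

covers-combine : ∀ {k A B p q} → CoversInterval k A p → CoversInterval k B q → CoversInterval k (combine (+ p) A B) (p * q)
covers-combine {k} {A} {B} {zero} {q} _ _ = + 0 , λ i 1≤i i≤0 → ⊥-elim (<⇒≱ 1≤i i≤0)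
covers-combine {k} {A} {B} {p@(suc _)} {q} (a , covA) (b , covB) = c , covered
  where
  -- Positions are counted from 1 but digits from 0: (a + 1 + r) + p (b + 1 + u) equals c + 1 + (r +
  -- u p), where r < p and u < q are the digits of the zero-based position.
  c = a ℤ.+ + p ℤ.* (b ℤ.+ + 1)
  covered : ∀ i → 1 ≤ i → i ≤ p * q → InSumset (combine (+ p) A B) k (c ℤ.+ + i)
  covered (suc i) _ i≤ = ∈⇒InSumset k (subst (_∈ k · combine (+ p) A B) eq
    (·-combine (+ p) {A} {B} k (InSumset⇒∈ (covA (suc r) (s≤s z≤n) (m%n<n i p)))
                       (InSumset⇒∈ (covB (suc u) (s≤s z≤n) (m<n*o⇒m/o<n (subst (i <_) (*-comm p q) i≤))))))
    where
    r = i % p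
    u = i / p
    digits : ∀ a b p r u → (a ℤ.+ (+ 1 ℤ.+ r)) ℤ.+ p ℤ.* (b ℤ.+ (+ 1 ℤ.+ u)) ≡ (a ℤ.+ p ℤ.* (b ℤ.+ + 1)) ℤ.+ (+ 1 ℤ.+ (r ℤ.+ u ℤ.* p))
    digits = ℤSolver.solve-∀
    eq : (a ℤ.+ + suc r) ℤ.+ + p ℤ.* (b ℤ.+ + suc u) ≡ c ℤ.+ + suc i
    eq = trans (digits a b (+ p) (+ r) (+ u)) (cong (λ z → c ℤ.+ (+ 1 ℤ.+ z))
      (trans (cong (λ z → + r ℤ.+ z) (sym (ℤ.pos-* u p))) (cong (λ n → + n) (sym (m≡m%n+[m/n]*n i p)))))

power : ℕ → List ℤ → ℕ → List ℤ
power q A zero = + 0 ∷ []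
power q A (suc m) = combine (+ q) A (power q A m)

power-covers : ∀ {k A q} → CoversInterval k A q → ∀ m → CoversInterval k (power q A m) (q ^ m)
-- The k-fold sum is 0 alone, so the interval of length 1 starts after -1.
power-covers {k} cov zero = -[1+ 0 ] , λ { (suc zero) _ _ → ∈⇒InSumset k (zero∈· k) ; (suc (suc _)) _ (s≤s ()) }
power-covers {k} {A} {q} cov (suc m) = covers-combine {k} {A} {power q A m} cov (power-covers {k} {A} {q} cov m)

card-power-⊖ : ∀ q A m → card (power q A m ⊖ power q A m) ≤ card (A ⊖ A) ^ m
card-power-⊖ q A zero = ≤-refl
card-power-⊖ q A (suc m) = begin
  card (P′ ⊖ P′)                                       ≤⟨ card≤length (combine (+ q) (nub (A ⊖ A)) (nub (P ⊖ P)))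
    (combine-⊖ (+ q) {A} {P} {nub (A ⊖ A)} {nub (P ⊖ P)} (∈-nub⁺ {A ⊖ A}) (∈-nub⁺ {P ⊖ P})) ⟩
  length (combine (+ q) (nub (A ⊖ A)) (nub (P ⊖ P)))   ≡⟨ length-cartesianProductWith _ (nub (A ⊖ A)) (nub (P ⊖ P)) ⟩
  card (A ⊖ A) * card (P ⊖ P)                          ≤⟨ *-monoʳ-≤ (card (A ⊖ A)) (card-power-⊖ q A m) ⟩
  card (A ⊖ A) * card (A ⊖ A) ^ m                      ∎
  where
  open ≤-Reasoning
  P = power q A m
  P′ = power q A (suc m)

-- For P = A + qA + ... + q^(m-1)A, the chain from q^m ≤ |(k+1)P| through kP to |P - P| costs a
-- constant C independent of m. Hence m removes C, with polynomial degree 0, and a k-th root is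
-- taken at the end.
beta-monotone : ∀ k s t → 1 ≤ k → BetaAtLeast k s (k * t) → BetaAtLeast (suc k) s (suc k * t)
beta-monotone k s t 1≤k β q 2≤q n (A , cov , dc) rewrite DiffCard⇒≡ dc =
  ^-cancelˡ-≤ k {{>-nonZero 1≤k}} (subst₂ _≤_ (^-swap q k s) eN
    (exponential-beats-polynomial ((q ^ k) ^ s) (N ^ (k * t * suc k)) C 0 bound))
  where
  open ≤-Reasoning
  N = card (A ⊖ A)
  C = (suc k ^ suc k) ^ s
  ^-cancelˡ-≤ : ∀ k .{{_ : NonZero k}} {a b} → a ^ k ≤ b ^ k → a ≤ b
  ^-cancelˡ-≤ k le = ≮⇒≥ λ b<a → <⇒≱ (^-monoˡ-< k b<a) le
  eN : N ^ (k * t * suc k) ≡ (N ^ (suc k * t)) ^ k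
  eN = trans (cong (N ^_) (rearrange k t)) (sym (^-*-assoc N (suc k * t) k))
    where
    rearrange : ∀ k t → k * t * suc k ≡ suc k * t * k
    rearrange = solve-∀
  bound : ∀ m → 1 ≤ m → ((q ^ k) ^ s) ^ m ≤ C * m ^ 0 * (N ^ (k * t * suc k)) ^ m
  bound m _ = begin
    ((q ^ k) ^ s) ^ m                  ≡⟨ ^-swap (q ^ k) s m ⟩
    ((q ^ k) ^ m) ^ s                  ≡⟨ cong (_^ s) (^-swap q k m) ⟩
    ((q ^ m) ^ k) ^ s                  ≤⟨ ^-monoˡ-≤ s (^-monoˡ-≤ k (covers⇒≤card {suc k} {P} covP)) ⟩
    (card (suc k · P) ^ k) ^ s         ≤⟨ ^-monoˡ-≤ s (card-·-suc k P P≢∅) ⟩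
    ((suc k * L) ^ suc k) ^ s          ≡⟨ cong (_^ s) (^-distribʳ-* (suc k) L (suc k)) ⟩
    (suc k ^ suc k * L ^ suc k) ^ s    ≡⟨ ^-distribʳ-* (suc k ^ suc k) (L ^ suc k) s ⟩
    C * (L ^ suc k) ^ s                ≡⟨ cong (C *_) (^-swap L (suc k) s) ⟩
    C * (L ^ s) ^ suc k                ≤⟨ *-monoʳ-≤ C (^-monoˡ-≤ (suc k) (beta-sumset k s (k * t) 1≤k β P P≢∅)) ⟩
    C * (card (P ⊖ P) ^ (k * t)) ^ suc k ≡⟨ cong (C *_) (^-*-assoc (card (P ⊖ P)) (k * t) (suc k)) ⟩
    C * card (P ⊖ P) ^ (k * t * suc k) ≤⟨ *-monoʳ-≤ C (^-monoˡ-≤ (k * t * suc k) (card-power-⊖ q A m)) ⟩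
    C * (N ^ m) ^ (k * t * suc k)      ≡⟨ cong₂ _*_ (sym (*-identityʳ C)) (^-swap N m (k * t * suc k)) ⟩
    C * 1 * (N ^ (k * t * suc k)) ^ m  ∎
    where
    P = power q A m
    L = card (k · P)
    covP : CoversInterval (suc k) P (q ^ m)
    covP = power-covers {suc k} {A} {q} cov m
    P≢∅ : 0 < card P
    P≢∅ = covers⇒inhabited {suc k} {P} (s≤s z≤n) (m^n>0 q {{>-nonZero (<⇒≤ 2≤q)}} m) covP

-- Digits in base b

digitMultiples : ℕ → ℕ → List ℤ
digitMultiples b k = cartesianProductWith (λ i d → + (d * b ^ i)) (upTo k) (upTo b)

-- The leading digit x / b^j is split off at place j and the remainder has j digits; a zero digit is
-- still a summand, so the number of summands is exact.
digit-expansion : ∀ b k .{{_ : NonZero b}} j → j ≤ k → ∀ x → x < b ^ j → InSumset (digitMultiples b k) j (+ x)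
digit-expansion b k zero _ zero _ = sum-zero
digit-expansion b k zero _ (suc x) (s≤s ())
digit-expansion b k (suc j) j<k x x< = subst (InSumset (digitMultiples b k) (suc j)) eq
  (sum-suc (∈-cartesianProductWith⁺ _ (∈-upTo⁺ j<k) (∈-upTo⁺ (m<n*o⇒m/o<n x<)))
           (digit-expansion b k j (<⇒≤ j<k) (x % b ^ j) (m%n<n x (b ^ j))))
  where
  instance
    bʲ≢0 : NonZero (b ^ j)
    bʲ≢0 = m^n≢0 b j
  eq : + (x / b ^ j * b ^ j) ℤ.+ + (x % b ^ j) ≡ + x
  eq = cong (λ n → + n) (trans (+-comm (x / b ^ j * b ^ j) (x % b ^ j)) (sym (m≡m%n+[m/n]*n x (b ^ j))))

digits-cover : ∀ b k .{{_ : NonZero b}} → CoversInterval k (digitMultiples b k) (b ^ k)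
-- The sums reach 0, ..., b^k - 1, so the interval starts after -1.
digits-cover b k = ℤ.- + 1 , λ { (suc i) _ i< → subst (InSumset (digitMultiples b k) k) (sym (cancel (+ i))) (digit-expansion b k k ≤-refl i i<) }
  where
  cancel : ∀ x → ℤ.- + 1 ℤ.+ (+ 1 ℤ.+ x) ≡ x
  cancel = ℤSolver.solve-∀

card-digits-⊖ : ∀ b k → card (digitMultiples b k ⊖ digitMultiples b k) ≤ (k * b) ^ 2
card-digits-⊖ b k = begin
  card (D ⊖ D)             ≤⟨ card≤length (D ⊖ D) id ⟩
  length (D ⊖ D)           ≡⟨ length-cartesianProductWith ℤ._-_ D D ⟩
  length D * length D      ≡⟨ cong₂ _*_ |D| (trans |D| (sym (*-identityʳ (k * b)))) ⟩
  (k * b) ^ 2              ∎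
  where
  open ≤-Reasoning
  D = digitMultiples b k
  |D| : length D ≡ k * b
  |D| = trans (length-cartesianProductWith _ (upTo k) (upTo b)) (cong₂ _*_ (length-upTo k) (length-upTo b))

-- The digit sets give b^(ks) ≤ (k b)^(2t) for every b ≥ 2. If 2t < sk, this leaves b ≤ k^(2t),
-- which fails for large b.
beta-upper : ∀ k s t → 1 ≤ k → BetaAtLeast k s t → s * k ≤ 2 * t
beta-upper k s t 1≤k β = ≮⇒≥ λ 2t<sk → <⇒≱ (s≤s (n≤1+n (k ^ (2 * t)))) (b≤ 2t<sk)
  where
  open ≤-Reasoning
  -- Larger than k^(2t), and visibly at least 2, so that q = b^k is admissible.
  b = suc (suc (k ^ (2 * t)))
  instance
    k≢0 : NonZero k
    k≢0 = >-nonZero 1≤k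
  2≤q : 2 ≤ b ^ k
  2≤q = ≤-trans (s≤s (s≤s z≤n)) (subst (_≤ b ^ k) (^-identityʳ b) (^-monoʳ-≤ b 1≤k))
  b≤ : 2 * t < s * k → b ≤ k ^ (2 * t)
  b≤ 2t<sk = *-cancelʳ-≤ b (k ^ (2 * t)) (b ^ (2 * t)) {{m^n≢0 b (2 * t)}} (begin
    b ^ suc (2 * t)              ≤⟨ ^-monoʳ-≤ b 2t<sk ⟩
    b ^ (s * k)                  ≡⟨ cong (b ^_) (*-comm s k) ⟩
    b ^ (k * s)                  ≡⟨ ^-*-assoc b k s ⟨
    (b ^ k) ^ s                  ≤⟨ β (b ^ k) 2≤q _ (digitMultiples b k , digits-cover b k , diffCard _) ⟩
    card (digitMultiples b k ⊖ digitMultiples b k) ^ t ≤⟨ ^-monoˡ-≤ t (card-digits-⊖ b k) ⟩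
    ((k * b) ^ 2) ^ t            ≡⟨ ^-*-assoc (k * b) 2 t ⟩
    (k * b) ^ (2 * t)            ≡⟨ ^-distribʳ-* k b (2 * t) ⟩
    k ^ (2 * t) * b ^ (2 * t)    ∎)

theorem4 : (∀ (k : ℕ) → 1 ≤ k → BetaAtLeast k (2 * k ∸ 1) (k * k))
    × (∀ (k s t : ℕ) → 1 ≤ k → 1 ≤ t → BetaAtLeast k s t → s * k ≤ 2 * t)
    × (∀ (k s t : ℕ) → 1 ≤ k → 1 ≤ t
    → BetaAtLeast k s (k * t) → BetaAtLeast (suc k) s (suc k * t))
theorem4 = beta-lower
  , (λ k s t 1≤k _ → beta-upper k s t 1≤k)
  , (λ k s t 1≤k _ → beta-monotone k s t 1≤k)
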